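{- Let $L/K$ be a field extension of degree $n$ and let $\mathfrak T=(n_1,\dots,n_t)$ be a tower type of degree $n$. Then the flag type $T(\mathfrak T)$ is realizable for $L/K$ (i.e. there is a flag $\mathcal F$ of $L$ over $K$ with $T_{\mathcal F}=T(\mathfrak T)$) if and only if $L/K$ has a tower of subfields \[K=L_0\subset L_1\subset\cdots\subset L_t=L\] such that $[L_i:L_{i-1}]=n_i$ and $L_i/L_{i-1}$ is a simple extension for all $1\le i\le t$.
   Context: For a positive integer $n$ let $[n]=\{0,\dots,n-1\}$. For a degree $n$ field extension $L/K$, a flag of $L$ over $K$ is an indexed family $\mathcal F=\{F_i\}_{i\in[n]}$ of $K$-subspaces of $L$ with $K=F_0\subset F_1\subset\cdots\subset F_{n-1}=L$ and $\dim_K F_i=i+1$. Its flag type is $T_{\mathcal F}:[n]\times[n]\to[n]$, $T_{\mathcal F}(i,j)=\min\{k\in[n]: F_iF_j\subseteq F_k\}$, where $F_iF_j$ is the $K$-span of all products $ab$ with $a\in F_i,b\in F_j$. A tower type of degree $n$ is a tuple $(n_1,\dots,n_t)$ of integers $>1$ with $n_1\cdots n_t=n$. Every $i\in[n]$ can be written uniquely in mixed radix notation as $i=i_1+i_2n_1+\cdots+i_tn_1\cdots n_{t-1}$ with $0\le i_s<n_s$. Let $H=C_{n_1}\times\cdots\times C_{n_t}$ (product of cyclic groups, written multiplicatively), $e_s$ a generator of the $s$-th factor, $v_i=e_1^{i_1}\cdots e_t^{i_t}$, $F_i=\{v_0,\dots,v_i\}$; $T(\mathfrak T):[n]\times[n]\to[n]$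 is $T(\mathfrak T)(i,j)=\min\{k: F_iF_j\subseteq F_k\}$ (products of subsets of $H$). -}

module Defs where

open import Level using (Level; _⊔_) renaming (suc to lsuc)
open import Algebra.Bundles using (CommutativeRing)
open import Data.Nat using (ℕ; zero; suc; _∸_; _≤_; _<_; _%_; _/_) renaming (_+_ to _+ℕ_)
open import Data.Nat.ListAction using (product)
open import Data.Fin using (Fin; toℕ; inject₁; fromℕ) renaming (zero to fzero; suc to fsuc)
open import Data.List using (List; []; _∷_; length; lookup)
open import Data.List.Relation.Unary.All using (All)
open import Data.Product using (Σ; ∃; ∃₂; _×_; _,_)
open import Relation.Nullary using (¬_)
open import Relation.Unary using (Pred; _⊆_)
open import Relation.Binary.PropositionalEquality using (_≡_)
open import Function.Bundles using (_⇔_)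

record Field c ℓ : Set (lsuc (c ⊔ ℓ)) where
  field
    commutativeRing : CommutativeRing c ℓ
  open CommutativeRing commutativeRing public
  field
    0≉1     : ¬ (0# ≈ 1#)
    inverse : ∀ x → ¬ (x ≈ 0#) → ∃ λ y → x * y ≈ 1#

-- Mixed radix digits and the group H = C_{n_1} × ... × C_{n_t}
-- (elements = exponent lists, group law = componentwise addition mod n_s).
-- We divide by  suc (m ∸ 1) , which equals m whenever m ≥ 1 (all n_s > 1
-- in a tower type), to avoid carrying NonZero instances.

digits : List ℕ → ℕ → List ℕ
digits []       i = []
digits (m ∷ ms) i = (i % suc (m ∸ 1)) ∷ digits ms (i / suc (m ∸ 1))

mulH : List ℕ → List ℕ → List ℕ → List ℕ
mulH (m ∷ ms) (x ∷ xs) (y ∷ ys) = ((x +ℕ y) % suc (m ∸ 1)) ∷ mulH ms xs ys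
mulH _        _        _        = []

IsTowerType : ℕ → List ℕ → Set
IsTowerType n ns = All (1 <_) ns × product ns ≡ n

-- v_i = digits ns i ;  F_i = {v_0,...,v_i} ;
-- F_i F_j ⊆ F_k  (products of subsets of H)
ProdSubH : List ℕ → ℕ → ℕ → ℕ → Set
ProdSubH ns i j k = ∀ a b → a ≤ i → b ≤ j →
  ∃ λ c → c ≤ k × digits ns c ≡ mulH ns (digits ns a) (digits ns b)

TowerTypeIs : List ℕ → ℕ → ℕ → ℕ → Set
TowerTypeIs ns i j k = ProdSubH ns i j k × (∀ k′ → k′ < k → ¬ ProdSubH ns i j k′)

module _ {c ℓ} (L : Field c ℓ) where
  open Field L

  record IsSubfield {p} (E : Pred Carrier p) : Set (c ⊔ ℓ ⊔ p) where
    field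
      resp  : ∀ {x y} → x ≈ y → E x → E y
      has0  : E 0#
      has1  : E 1#
      +-cl  : ∀ {x y} → E x → E y → E (x + y)
      neg-cl : ∀ {x} → E x → E (- x)
      *-cl  : ∀ {x y} → E x → E y → E (x * y)
      inv-cl : ∀ {x y} → E x → x * y ≈ 1# → E y

  record IsSubspace {p q} (S : Pred Carrier p) (V : Pred Carrier q) : Set (c ⊔ ℓ ⊔ p ⊔ q) where
    field
      resp  : ∀ {x y} → x ≈ y → V x → V y
      has0  : V 0#
      +-cl  : ∀ {x y} → V x → V y → V (x + y)
      smul  : ∀ {k x} → S k → V x → V (k * x)

  sumF : ∀ {d} → (Fin d → Carrier) → Carrier
  sumF {zero}  f = 0#
  sumF {suc d} f = f fzero + sumF (λ i → f (fsuc i))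

  LinIndep : ∀ {p} (S : Pred Carrier p) {d} → (Fin d → Carrier) → Set (c ⊔ ℓ ⊔ p)
  LinIndep S {d} b = ∀ (co : Fin d → Carrier) → (∀ i → S (co i)) →
    sumF (λ i → co i * b i) ≈ 0# → ∀ i → co i ≈ 0#

  HasDim : ∀ {p q} (S : Pred Carrier p) (V : Pred Carrier q) → ℕ → Set (c ⊔ ℓ ⊔ p ⊔ q)
  HasDim S V d = Σ (Fin d → Carrier) λ b →
    (∀ i → V (b i)) × LinIndep S b ×
    (∀ x → V x → Σ (Fin d → Carrier) λ co → (∀ i → S (co i)) × x ≈ sumF (λ i → co i * b i))

  data Span {p q} (S : Pred Carrier p) (A : Pred Carrier q) : Pred Carrier (c ⊔ ℓ ⊔ p ⊔ q) where
    sp-zero : Span S A 0#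
    sp-step : ∀ {k a x} → S k → A a → Span S A x → Span S A (k * a + x)
    sp-resp : ∀ {x y} → x ≈ y → Span S A x → Span S A y

  Products : ∀ {p q} → Pred Carrier p → Pred Carrier q → Pred Carrier (c ⊔ ℓ ⊔ p ⊔ q)
  Products A B x = ∃₂ λ a b → A a × B b × x ≈ a * b

  record IsFlag {p} (K : Pred Carrier p) (n : ℕ) (F : Fin n → Pred Carrier (c ⊔ ℓ)) : Set (c ⊔ ℓ ⊔ p) where
    field
      subspace : ∀ i → IsSubspace K (F i)
      dim      : ∀ i → HasDim K (F i) (suc (toℕ i))
      mono     : ∀ i j → toℕ i ≤ toℕ j → F i ⊆ F j
      first⊆K  : ∀ i → toℕ i ≡ 0 → F i ⊆ K
      K⊆first  : ∀ i → toℕ i ≡ 0 → K ⊆ F i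
      last     : ∀ i → suc (toℕ i) ≡ n → ∀ x → F i x

  ProdSubF : ∀ {p} (K : Pred Carrier p) {n} → (Fin n → Pred Carrier (c ⊔ ℓ)) → Fin n → Fin n → Fin n → Set (c ⊔ ℓ ⊔ p)
  ProdSubF K F i j k = Span K (Products (F i) (F j)) ⊆ F k

  FlagTypeIs : ∀ {p} (K : Pred Carrier p) {n} → (Fin n → Pred Carrier (c ⊔ ℓ)) → Fin n → Fin n → Fin n → Set (c ⊔ ℓ ⊔ p)
  FlagTypeIs K F i j k = ProdSubF K F i j k × (∀ k′ → toℕ k′ < toℕ k → ¬ ProdSubF K F i j k′)

  Realizable : ∀ {p} (K : Pred Carrier p) (n : ℕ) (ns : List ℕ) → Set (lsuc (c ⊔ ℓ) ⊔ p)
  Realizable K n ns = Σ (Fin n → Pred Carrier (c ⊔ ℓ)) λ F →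
    IsFlag K n F ×
    (∀ i j k → FlagTypeIs K F i j k ⇔ TowerTypeIs ns (toℕ i) (toℕ j) (toℕ k))

  data Adjoin {p} (E : Pred Carrier p) (α : Carrier) : Pred Carrier (c ⊔ ℓ ⊔ p) where
    ad-base : ∀ {x} → E x → Adjoin E α x
    ad-gen  : Adjoin E α α
    ad-+    : ∀ {x y} → Adjoin E α x → Adjoin E α y → Adjoin E α (x + y)
    ad-neg  : ∀ {x} → Adjoin E α x → Adjoin E α (- x)
    ad-*    : ∀ {x y} → Adjoin E α x → Adjoin E α y → Adjoin E α (x * y)
    ad-inv  : ∀ {x y} → Adjoin E α x → x * y ≈ 1# → Adjoin E α y
    ad-resp : ∀ {x y} → x ≈ y → Adjoin E α x → Adjoin E α y

  SimpleExt : ∀ {p q} → Pred Carrier p → Pred Carrier q → Set (c ⊔ ℓ ⊔ p ⊔ q)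
  SimpleExt E E′ = ∃ λ α → (E′ ⊆ Adjoin E α) × (Adjoin E α ⊆ E′)

  HasSimpleTower : ∀ {p} (K : Pred Carrier p) (ns : List ℕ) → Set (lsuc (c ⊔ ℓ) ⊔ p)
  HasSimpleTower K ns = Σ (Fin (suc (length ns)) → Pred Carrier (c ⊔ ℓ)) λ Ls →
    (∀ s → IsSubfield (Ls s)) ×
    (Ls fzero ⊆ K) × (K ⊆ Ls fzero) ×
    (∀ x → Ls (fromℕ (length ns)) x) ×
    (∀ (s : Fin (length ns)) →
       (Ls (inject₁ s) ⊆ Ls (fsuc s)) ×
       HasDim (Ls (inject₁ s)) (Ls (fsuc s)) (lookup ns s) ×
       SimpleExt (Ls (inject₁ s)) (Ls (fsuc s)))

{-# OPTIONS --safe #-}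
module Submission where

-- Write G_k for the member of dimension k of a flag and N = n₁⋯n_s.
--
-- From a flag to a tower: the values of T(𝔗) give that G_N is a field E, that G_(N+1) is
-- E + Kα for some α outside E, and that E G_(jN) ⊆ G_(jN) and G_(jN) α ⊆ G_((j+1)N) for j < m,
-- where m = n_(s+1), while G_(jN) α ⊈ G_(jN). By induction on j, the powers 1, α, …, α^(j-1) form
-- a basis of G_(jN) over E; for j = m this is the next step E(α) of the tower.
--
-- From a tower to a flag: the monomials v_i = α₁^(i₁)⋯α_t^(i_t) form a basis of L over K, and the
-- flag consists of the spans of v_0, …, v_i. If adding the digits of a and b produces no carry,
-- then v_a v_b = v_(a+b). Otherwise v_a v_b lies in the span of v_0, …, v_k, where k has the
-- digits of a + b above the highest carrying position and maximal digits from there on; as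
-- k = a′ + b′ without carry for some a′ ≤ a and b′ ≤ b, T(𝔗) takes at least the value k.
--
-- Equality in a field is not assumed decidable, nor even stable under double negation. A basis is
-- therefore recognised by its determinant: classical reasoning shows that the determinant is not
-- zero, hence invertible, and Cramer's rule then yields coefficients. Determinants are taken in
-- the exterior algebra.

-- The delicate point from flag to tower is the choice of α. A basis of G_(N+1) cannot lie entirely
-- in E, but no particular member outside E can be pointed out. So α is a K-combination of the whole
-- basis: the determinant of α followed by a basis of E is a linear form in the coefficients of α,
-- and inverting one nonzero element of L produces coefficients at which this form equals 1.
-- Dimensions over E then come from a count over K: the products of a basis of E with the powers of
-- α are as many as the dimension prescribed by the flag, so independence alone gives a basis. In
-- the other direction, the inclusion of the next field in E(α) serves to show that α^d is not
-- spanned by lower powers, a negative statement. Hence membership in a span up to double negation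
-- suffices, and inverses in E(α) need not be written in terms of powers. The values of T(𝔗) are
-- decidable, those of a given flag are not: on the way to the tower, minima are found in H and then
-- transported to the flag.

open import Defs
open import Level using (_⊔_)
open import Algebra.Bundles using (CommutativeRing; RawRing; Ring)
open import Algebra.Morphism.Structures using (IsRingMonomorphism)
import Algebra.Morphism.RingMonomorphism as RingMonomorphism
import Algebra.Properties.CommutativeSemigroup as CommutativeSemigroupProperties
import Algebra.Properties.Ring as RingProperties
open import Data.Bool using (Bool; true; false)
open import Data.Empty using (⊥; ⊥-elim)
open import Data.Fin using (Fin; toℕ; fromℕ; fromℕ<; inject₁) renaming (zero to fzero; suc to fsuc)
import Data.Fin.Properties as Fin
open import Data.List using (List; []; _∷_; _++_; length; lookup; take; drop)
import Data.List.Properties as List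
open import Data.List.Relation.Unary.All using (All; []; _∷_)
import Data.List.Relation.Unary.All.Properties as All
open import Data.Nat using (ℕ; zero; suc; z≤n; s≤s; s<s; z<s; s≤s⁻¹; _<_; _≤_; NonZero; _%_; _/_; _∸_)
  renaming (_+_ to _+ℕ_; _*_ to _*ℕ_)
open import Data.Nat.DivMod
open import Data.Nat.ListAction using (product)
open import Data.Nat.ListAction.Properties using (product-++)
import Data.Nat.Properties as ℕ
open import Data.Product using (Σ; ∃; ∃₂; _×_; _,_; proj₁; proj₂)
open import Data.Sum using (_⊎_; inj₁; inj₂)
open import Data.Unit.Polymorphic using (⊤; tt)
open import Data.Vec using (Vec; []; _∷_; replicate)
open import Function using (_∘_; id; mk⇔)
open import Function.Bundles using (_⇔_; Equivalence)
open import Relation.Nullary using (¬_; Dec; yes; no)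
open import Relation.Nullary.Decidable using (map′; decidable-stable)
open import Relation.Unary using (Pred; _⊆_)
open import Relation.Binary.PropositionalEquality as ≡ using (_≡_; _≢_)

-- Sums and exterior algebra

module Sums {c ℓ} (R : CommutativeRing c ℓ) where
  open CommutativeRing R
  open import Relation.Binary.Reasoning.Setoid setoid
  open CommutativeSemigroupProperties +-commutativeSemigroup using (interchange)

  ∑ : ℕ → (ℕ → Carrier) → Carrier
  ∑ zero    f = 0#
  ∑ (suc n) f = f 0 + ∑ n (f ∘ suc)

  ∑-cong : ∀ n {f g} → (∀ i → i < n → f i ≈ g i) → ∑ n f ≈ ∑ n g
  ∑-cong zero    eq = refl
  ∑-cong (suc n) eq = +-cong (eq 0 z<s) (∑-cong n (λ i i<n → eq (suc i) (s<s i<n)))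

  ∑-zero : ∀ n {f} → (∀ i → i < n → f i ≈ 0#) → ∑ n f ≈ 0#
  ∑-zero zero    eq = refl
  ∑-zero (suc n) eq =
    trans (+-cong (eq 0 z<s) (∑-zero n (λ i i<n → eq (suc i) (s<s i<n)))) (+-identityˡ 0#)

  ∑-+ : ∀ n f g → ∑ n (λ i → f i + g i) ≈ ∑ n f + ∑ n g
  ∑-+ zero    f g = sym (+-identityˡ 0#)
  ∑-+ (suc n) f g = trans (+-congˡ (∑-+ n (f ∘ suc) (g ∘ suc))) (interchange _ _ _ _)

  *-∑ : ∀ n x f → x * ∑ n f ≈ ∑ n (λ i → x * f i)
  *-∑ zero    x f = zeroʳ x
  *-∑ (suc n) x f = trans (distribˡ x _ _) (+-congˡ (*-∑ n x (f ∘ suc)))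

  ∑-* : ∀ n f x → ∑ n f * x ≈ ∑ n (λ i → f i * x)
  ∑-* n f x = trans (*-comm _ x) (trans (*-∑ n x f) (∑-cong n (λ i _ → *-comm x (f i))))

  ∑-split : ∀ m n f → ∑ (m +ℕ n) f ≈ ∑ m f + ∑ n (λ i → f (m +ℕ i))
  ∑-split zero    n f = sym (+-identityˡ _)
  ∑-split (suc m) n f = trans (+-congˡ (∑-split m n (f ∘ suc))) (sym (+-assoc _ _ _))

  ∑-last : ∀ n f → ∑ (suc n) f ≈ ∑ n f + f n
  ∑-last zero    f = +-comm (f 0) 0#
  ∑-last (suc n) f = trans (+-congˡ (∑-last n (f ∘ suc))) (sym (+-assoc _ _ _))

  ∑-blocks : ∀ q m f → ∑ (q *ℕ m) f ≈ ∑ q (λ l → ∑ m (λ i → f (i +ℕ l *ℕ m)))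
  ∑-blocks zero    m f = refl
  ∑-blocks (suc q) m f = begin
    ∑ (m +ℕ q *ℕ m) f                            ≈⟨ ∑-split m (q *ℕ m) f ⟩
    ∑ m f + ∑ (q *ℕ m) (λ i → f (m +ℕ i))         ≈⟨ +-cong
      (∑-cong m (λ i _ → reflexive (≡.cong f (≡.sym (ℕ.+-identityʳ i)))))
      (trans (∑-blocks q m (λ i → f (m +ℕ i))) (∑-cong q (λ l _ → ∑-cong m (λ i _ →
        reflexive (≡.cong f (ℕ-x∙yz≈y∙xz m i (l *ℕ m))))))) ⟩
    ∑ (suc q) (λ l → ∑ m (λ i → f (i +ℕ l *ℕ m))) ∎
    where open CommutativeSemigroupProperties ℕ.+-commutativeSemigroup
            using () renaming (x∙yz≈y∙xz to ℕ-x∙yz≈y∙xz)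

  ∑-swap : ∀ m n (g : ℕ → ℕ → Carrier) →
    ∑ m (λ i → ∑ n (g i)) ≈ ∑ n (λ j → ∑ m (λ i → g i j))
  ∑-swap zero    n g = sym (∑-zero n (λ _ _ → refl))
  ∑-swap (suc m) n g =
    trans (+-congˡ (∑-swap m n (g ∘ suc))) (sym (∑-+ n (g 0) _))

  indicator : ℕ → ℕ → Carrier
  indicator zero    zero    = 1#
  indicator zero    (suc j) = 0#
  indicator (suc i) zero    = 0#
  indicator (suc i) (suc j) = indicator i j

  ∑-indicator : ∀ n i (f : ℕ → Carrier) → i < n → ∑ n (λ j → indicator i j * f j) ≈ f i
  ∑-indicator (suc n) zero    f _ = begin
    1# * f 0 + ∑ n (λ j → 0# * f (suc j)) ≈⟨ +-cong (*-identityˡ _) (∑-zero n (λ j _ → zeroˡ _)) ⟩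
    f 0 + 0#                              ≈⟨ +-identityʳ _ ⟩
    f 0                                   ∎
  ∑-indicator (suc n) (suc i) f (s≤s i<n) = begin
    0# * f 0 + ∑ n (λ j → indicator i j * f (suc j)) ≈⟨ +-cong (zeroˡ _) (∑-indicator n i (f ∘ suc) i<n) ⟩
    0# + f (suc i)                                   ≈⟨ +-identityˡ _ ⟩
    f (suc i)                                        ∎

_◃_ : ∀ {a} {A : Set a} → A → (ℕ → A) → ℕ → A
(x ◃ f) zero    = x
(x ◃ f) (suc i) = f i

module Exterior {c ℓ} (R : CommutativeRing c ℓ) where
  open CommutativeRing R
  open import Relation.Binary.Reasoning.Setoid setoid
  open RingProperties ring
  open CommutativeSemigroupProperties +-commutativeSemigroup using (interchange)
  open CommutativeSemigroupProperties *-commutativeSemigroup using (x∙yz≈y∙xz)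
  open Sums R

  -- The exterior algebra of R^N: a form is its family of coefficients, indexed by the
  -- subsets of the N basis vectors.
  Form : ℕ → Set c
  Form N = Vec Bool N → Carrier

  -- With e₀ the first basis vector, write f = f₀e₀ + f′ and ω = ω₀ + e₀ ∧ ω₁, where f′, ω₀ and ω₁
  -- do not involve e₀. Then f ∧ ω = f′ ∧ ω₀ + e₀ ∧ (f₀ω₀ - f′ ∧ ω₁).
  wedge : ∀ {N} → (ℕ → Carrier) → Form N → Form N
  wedge f ω []          = 0#
  wedge f ω (false ∷ σ) = wedge (f ∘ suc) (ω ∘ (false ∷_)) σ
  wedge f ω (true  ∷ σ) = f 0 * ω (false ∷ σ) - wedge (f ∘ suc) (ω ∘ (true ∷_)) σ

  -cancel : ∀ x y → x - (x - y) ≈ y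
  -cancel x y = begin
    x - (x - y)       ≈⟨ +-congˡ (⁻¹-anti-homo-// x y) ⟩
    x + (y - x)       ≈⟨ +-comm _ _ ⟩
    y - x + x         ≈⟨ +-assoc _ _ _ ⟩
    y + (- x + x)     ≈⟨ +-congˡ (-‿inverseˡ x) ⟩
    y + 0#            ≈⟨ +-identityʳ y ⟩
    y                 ∎

  -‿interchange : ∀ a b x y → (a - x) + (b - y) ≈ (a + b) - (x + y)
  -‿interchange a b x y = trans (interchange a (- x) b (- y)) (+-congˡ (-‿+-comm x y))

  wedge-cong : ∀ {N} f {ω η : Form N} → (∀ σ → ω σ ≈ η σ) → ∀ σ → wedge f ω σ ≈ wedge f η σ
  wedge-cong f eq []          = refl
  wedge-cong f eq (false ∷ σ) = wedge-cong (f ∘ suc) (eq ∘ (false ∷_)) σ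
  wedge-cong f eq (true  ∷ σ) =
    +-cong (*-congˡ (eq (false ∷ σ))) (-‿cong (wedge-cong (f ∘ suc) (eq ∘ (true ∷_)) σ))

  wedge-+ : ∀ {N} f (ω η : Form N) σ →
    wedge f (λ τ → ω τ + η τ) σ ≈ wedge f ω σ + wedge f η σ
  wedge-+ f ω η []          = sym (+-identityˡ 0#)
  wedge-+ f ω η (false ∷ σ) = wedge-+ (f ∘ suc) _ _ σ
  wedge-+ f ω η (true  ∷ σ) =
    trans (+-cong (distribˡ _ _ _) (-‿cong (wedge-+ (f ∘ suc) _ _ σ)))
          (sym (-‿interchange _ _ _ _))

  wedge-* : ∀ {N} f a (ω : Form N) σ → wedge f (λ τ → a * ω τ) σ ≈ a * wedge f ω σ
  wedge-* f a ω []          = sym (zeroʳ a)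
  wedge-* f a ω (false ∷ σ) = wedge-* (f ∘ suc) a _ σ
  wedge-* f a ω (true  ∷ σ) = begin
    f 0 * (a * ω (false ∷ σ)) - wedge (f ∘ suc) (λ τ → a * ω (true ∷ τ)) σ
      ≈⟨ +-cong (x∙yz≈y∙xz _ _ _) (-‿cong (wedge-* (f ∘ suc) a _ σ)) ⟩
    a * (f 0 * ω (false ∷ σ)) - a * wedge (f ∘ suc) (ω ∘ (true ∷_)) σ
      ≈⟨ x[y-z]≈xy-xz _ _ _ ⟨
    a * wedge f ω (true ∷ σ) ∎

  wedge-zero : ∀ {N} f {ω : Form N} → (∀ σ → ω σ ≈ 0#) → ∀ σ → wedge f ω σ ≈ 0#
  wedge-zero f {ω} eq σ = begin
    wedge f ω σ               ≈⟨ wedge-cong f (λ τ → trans (eq τ) (sym (zeroˡ 0#))) σ ⟩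
    wedge f (λ _ → 0# * 0#) σ ≈⟨ wedge-* f 0# (λ _ → 0#) σ ⟩
    0# * wedge f (λ _ → 0#) σ ≈⟨ zeroˡ _ ⟩
    0#                        ∎

  wedge-neg : ∀ {N} f (ω : Form N) σ → wedge f (λ τ → - ω τ) σ ≈ - wedge f ω σ
  wedge-neg f ω σ = begin
    wedge f (λ τ → - ω τ) σ      ≈⟨ wedge-cong f (λ τ → sym (-1*x≈-x (ω τ))) σ ⟩
    wedge f (λ τ → - 1# * ω τ) σ ≈⟨ wedge-* f (- 1#) ω σ ⟩
    - 1# * wedge f ω σ           ≈⟨ -1*x≈-x _ ⟩
    - wedge f ω σ                ∎

  wedge-- : ∀ {N} f (ω η : Form N) σ →
    wedge f (λ τ → ω τ - η τ) σ ≈ wedge f ω σ - wedge f η σ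
  wedge-- f ω η σ = trans (wedge-+ f ω _ σ) (+-congˡ (wedge-neg f η σ))

  wedge-∑ : ∀ {N} f n (a : ℕ → Carrier) (ω : ℕ → Form N) σ →
    wedge f (λ τ → ∑ n (λ i → a i * ω i τ)) σ ≈ ∑ n (λ i → a i * wedge f (ω i) σ)
  wedge-∑ f zero    a ω σ = wedge-zero f (λ _ → refl) σ
  wedge-∑ f (suc n) a ω σ =
    trans (wedge-+ f _ _ σ) (+-cong (wedge-* f (a 0) (ω 0) σ) (wedge-∑ f n (a ∘ suc) (ω ∘ suc) σ))

  -- A coefficient of f ∧ ω is a linear form in f. Its explicit vector `u` does the work of
  -- additivity in the first argument: linear relations between vectors pass through `u`. For a
  -- determinant, `u` collects the signed minors.
  wedge-coordinates : ∀ {N} (ω : Form N) σ →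
    ∃ λ (u : ℕ → Carrier) → ∀ f → wedge f ω σ ≈ ∑ N (λ j → f j * u j)
  wedge-coordinates ω [] = (λ _ → 0#) , λ _ → refl
  wedge-coordinates ω (false ∷ σ) with u , eq ← wedge-coordinates (ω ∘ (false ∷_)) σ =
    (0# ◃ u) , λ f → trans (eq (f ∘ suc)) (sym (trans (+-congʳ (zeroʳ (f 0))) (+-identityˡ _)))
  wedge-coordinates {suc N} ω (true ∷ σ) with u , eq ← wedge-coordinates (ω ∘ (true ∷_)) σ =
    (ω (false ∷ σ) ◃ (λ j → - u j)) , λ f → +-congˡ (begin
      - wedge (f ∘ suc) (ω ∘ (true ∷_)) σ   ≈⟨ -‿cong (eq (f ∘ suc)) ⟩
      - ∑ N (λ j → f (suc j) * u j)         ≈⟨ -1*x≈-x _ ⟨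
      - 1# * ∑ N (λ j → f (suc j) * u j)    ≈⟨ *-∑ N (- 1#) _ ⟩
      ∑ N (λ j → - 1# * (f (suc j) * u j))  ≈⟨ ∑-cong N (λ j _ →
        trans (-1*x≈-x _) (-‿distribʳ-* _ _)) ⟩
      ∑ N (λ j → f (suc j) * - u j)         ∎)

  -- The two occurrences of f₀e₀ ∧ f′ ∧ ω₀ cancel. Anticommutativity would only show that twice the
  -- form is zero, which is void in characteristic 2.
  wedge-square : ∀ {N} f (ω : Form N) σ → wedge f (wedge f ω) σ ≈ 0#
  wedge-square f ω []          = refl
  wedge-square f ω (false ∷ σ) = wedge-square (f ∘ suc) _ σ
  wedge-square f ω (true  ∷ σ) = begin
    f 0 * W - wedge f′ (λ τ → f 0 * ω (false ∷ τ) - wedge f′ (ω ∘ (true ∷_)) τ) σ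
      ≈⟨ +-congˡ (-‿cong (trans (wedge-- f′ _ _ σ)
           (+-cong (wedge-* f′ (f 0) _ σ) (-‿cong (wedge-square f′ _ σ))))) ⟩
    f 0 * W - (f 0 * W - 0#) ≈⟨ -cancel _ _ ⟩
    0#                       ∎
    where f′ = f ∘ suc
          W  = wedge f′ (ω ∘ (false ∷_)) σ

  wedge-anticomm : ∀ {N} f g (ω : Form N) σ → wedge f (wedge g ω) σ ≈ - wedge g (wedge f ω) σ
  wedge-anticomm f g ω []          = sym -0#≈0#
  wedge-anticomm f g ω (false ∷ σ) = wedge-anticomm (f ∘ suc) (g ∘ suc) _ σ
  wedge-anticomm f g ω (true  ∷ σ) = begin
    f 0 * G - wedge f′ (λ τ → g 0 * ω (false ∷ τ) - wedge g′ (ω ∘ (true ∷_)) τ) σ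
      ≈⟨ +-congˡ (-‿cong (expand f′ g)) ⟩
    f 0 * G - (g 0 * F - wedge f′ (wedge g′ (ω ∘ (true ∷_))) σ)
      ≈⟨ +-congˡ (-‿cong (+-congˡ (-‿cong (wedge-anticomm f′ g′ (ω ∘ (true ∷_)) σ)))) ⟩
    f 0 * G - (g 0 * F - (- V))
      ≈⟨ +-congˡ (⁻¹-anti-homo-// _ _) ⟩
    f 0 * G + (- V - g 0 * F)
      ≈⟨ +-assoc _ _ _ ⟨
    (f 0 * G - V) - g 0 * F
      ≈⟨ ⁻¹-anti-homo-// _ _ ⟨
    - (g 0 * F - (f 0 * G - V))
      ≈⟨ -‿cong (+-congˡ (-‿cong (expand g′ f))) ⟨
    - (g 0 * F - wedge g′ (λ τ → f 0 * ω (false ∷ τ) - wedge f′ (ω ∘ (true ∷_)) τ) σ) ∎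
    where
    f′ = f ∘ suc
    g′ = g ∘ suc
    F  = wedge f′ (ω ∘ (false ∷_)) σ
    G  = wedge g′ (ω ∘ (false ∷_)) σ
    V  = wedge g′ (wedge f′ (ω ∘ (true ∷_))) σ
    expand : ∀ (h k : ℕ → Carrier) → wedge h (λ τ → k 0 * ω (false ∷ τ) - wedge (k ∘ suc) (ω ∘ (true ∷_)) τ) σ ≈
      k 0 * wedge h (ω ∘ (false ∷_)) σ - wedge h (wedge (k ∘ suc) (ω ∘ (true ∷_))) σ
    expand h k = trans (wedge-- h _ _ σ) (+-congʳ (wedge-* h (k 0) _ σ))

  -- Interior product with the `k`-th coordinate form; the sign in the last clause comes from moving
  -- it past the first basis vector.
  contract : ∀ {N} → ℕ → Form N → Form N
  contract k       ω []          = 0#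
  contract zero    ω (false ∷ σ) = ω (true ∷ σ)
  contract zero    ω (true  ∷ σ) = 0#
  contract (suc k) ω (false ∷ σ) = contract k (ω ∘ (false ∷_)) σ
  contract (suc k) ω (true  ∷ σ) = - contract k (ω ∘ (true ∷_)) σ

  contract-zero : ∀ {N} k {ω : Form N} → (∀ σ → ω σ ≈ 0#) → ∀ σ → contract k ω σ ≈ 0#
  contract-zero k       eq []          = refl
  contract-zero zero    eq (false ∷ σ) = eq (true ∷ σ)
  contract-zero zero    eq (true  ∷ σ) = refl
  contract-zero (suc k) eq (false ∷ σ) = contract-zero k (eq ∘ (false ∷_)) σ
  contract-zero (suc k) eq (true  ∷ σ) =
    trans (-‿cong (contract-zero k (eq ∘ (true ∷_)) σ)) -0#≈0#

  contract-combination : ∀ {N} k a (ω η : Form N) σ →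
    contract k (λ τ → a * ω τ - η τ) σ ≈ a * contract k ω σ - contract k η σ
  contract-combination k a ω η [] =
    sym (trans (+-cong (zeroʳ a) -0#≈0#) (+-identityˡ 0#))
  contract-combination zero a ω η (false ∷ σ) = refl
  contract-combination zero a ω η (true  ∷ σ) =
    sym (trans (+-cong (zeroʳ a) -0#≈0#) (+-identityˡ 0#))
  contract-combination (suc k) a ω η (false ∷ σ) = contract-combination k a _ _ σ
  contract-combination (suc k) a ω η (true  ∷ σ) =
    trans (-‿cong (contract-combination k a _ _ σ))
      (trans (sym (-‿+-comm _ _)) (+-congʳ (-‿distribʳ-* _ _)))

  -- The interior product is an antiderivation. The bound matters: for larger `k` the contraction is
  -- zero, whereas `f k` is arbitrary.
  contract-wedge : ∀ {N} k f (ω : Form N) σ → k < N →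
    contract k (wedge f ω) σ ≈ f k * ω σ - wedge f (contract k ω) σ
  contract-wedge zero f ω (false ∷ σ) _ = refl
  contract-wedge zero f ω (true  ∷ σ) _ = begin
    0#                                   ≈⟨ -‿inverseʳ _ ⟨
    f 0 * ω (true ∷ σ) - f 0 * ω (true ∷ σ)
      ≈⟨ +-congˡ (-‿cong (trans (+-congˡ (trans
           (-‿cong (wedge-zero (f ∘ suc) (λ _ → refl) σ)) -0#≈0#)) (+-identityʳ _))) ⟨
    f 0 * ω (true ∷ σ) - wedge f (contract 0 ω) (true ∷ σ) ∎
  contract-wedge (suc k) f ω (false ∷ σ) (s≤s k<N) = contract-wedge k (f ∘ suc) _ σ k<N
  contract-wedge (suc k) f ω (true  ∷ σ) (s≤s k<N) = begin
    - contract k (λ τ → f 0 * ω (false ∷ τ) - wedge f′ (ω ∘ (true ∷_)) τ) σ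
      ≈⟨ -‿cong (trans (contract-combination k (f 0) _ _ σ)
           (+-congˡ (-‿cong (contract-wedge k f′ _ σ k<N)))) ⟩
    - (f 0 * X - (f (suc k) * Y - Z))
      ≈⟨ ⁻¹-anti-homo-// _ _ ⟩
    (f (suc k) * Y - Z) - f 0 * X
      ≈⟨ +-assoc _ _ _ ⟩
    f (suc k) * Y + (- Z - f 0 * X)
      ≈⟨ +-congˡ (trans (+-congʳ (sym (wedge-neg f′ _ σ))) (sym (⁻¹-anti-homo-// _ _))) ⟩
    f (suc k) * Y - (f 0 * X - wedge f′ (λ τ → - contract k (ω ∘ (true ∷_)) τ) σ) ∎
    where
    f′ = f ∘ suc
    X  = contract k (ω ∘ (false ∷_)) σ
    Y  = ω (true ∷ σ)
    Z  = wedge f′ (contract k (ω ∘ (true ∷_))) σ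

  size : ∀ {N} → Vec Bool N → ℕ
  size []          = 0
  size (false ∷ σ) = size σ
  size (true  ∷ σ) = suc (size σ)

  size≤N : ∀ {N} (σ : Vec Bool N) → size σ ≤ N
  size≤N []          = z≤n
  size≤N (false ∷ σ) = ℕ.m≤n⇒m≤1+n (size≤N σ)
  size≤N (true  ∷ σ) = s≤s (size≤N σ)

  full : ∀ {N} → Vec Bool N
  full {N} = replicate N true

  size≡N⇒full : ∀ {N} (σ : Vec Bool N) → size σ ≡ N → σ ≡ full
  size≡N⇒full []          _  = ≡.refl
  size≡N⇒full (false ∷ σ) eq = ⊥-elim (ℕ.<-irrefl eq (s≤s (size≤N σ)))
  size≡N⇒full (true  ∷ σ) eq = ≡.cong (true ∷_) (size≡N⇒full σ (ℕ.suc-injective eq))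

  -- The offset h absorbs the basis vectors already split off, so that no predecessor occurs.
  wedge-degree : ∀ {N} h k f (ω : Form N) → (∀ σ → h +ℕ size σ ≢ k → ω σ ≈ 0#) →
    ∀ σ → h +ℕ size σ ≢ suc k → wedge f ω σ ≈ 0#
  wedge-degree h k f ω hom []          _  = refl
  wedge-degree h k f ω hom (false ∷ σ) ne = wedge-degree h k (f ∘ suc) _ (hom ∘ (false ∷_)) σ ne
  wedge-degree h k f ω hom (true  ∷ σ) ne = begin
    f 0 * ω (false ∷ σ) - wedge (f ∘ suc) (ω ∘ (true ∷_)) σ
      ≈⟨ +-cong (trans (*-congˡ (hom (false ∷ σ) λ eq →
           ne (≡.trans (ℕ.+-suc h _) (≡.cong suc eq)))) (zeroʳ _))
         (-‿cong (wedge-degree (suc h) k (f ∘ suc) _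
           (λ τ ne′ → hom (true ∷ τ) (ne′ ∘ ≡.trans (≡.sym (ℕ.+-suc h _)))) σ
           (ne ∘ ≡.trans (ℕ.+-suc h _)))) ⟩
    0# - 0# ≈⟨ -‿inverseʳ 0# ⟩
    0#      ∎

  one : ∀ {N} → Form N
  one []          = 1#
  one (false ∷ σ) = one σ
  one (true  ∷ σ) = 0#

  one-degree : ∀ {N} (σ : Vec Bool N) → size σ ≢ 0 → one σ ≈ 0#
  one-degree []          ne = ⊥-elim (ne ≡.refl)
  one-degree (false ∷ σ) ne = one-degree σ ne
  one-degree (true  ∷ σ) ne = refl

  one-empty : ∀ N → one (replicate N false) ≈ 1#
  one-empty zero    = refl
  one-empty (suc N) = one-empty N

  ⋀ : ∀ {N} → (ℕ → ℕ → Carrier) → ℕ → Form N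
  ⋀ v zero    = one
  ⋀ v (suc k) = wedge (v 0) (⋀ (v ∘ suc) k)

  ⋀-degree : ∀ {N} v k (σ : Vec Bool N) → size σ ≢ k → ⋀ v k σ ≈ 0#
  ⋀-degree v zero    = one-degree
  ⋀-degree v (suc k) = wedge-degree 0 k (v 0) _ (⋀-degree (v ∘ suc) k)

  ⋀-overfull : ∀ {N} v (σ : Vec Bool N) → ⋀ v (suc N) σ ≈ 0#
  ⋀-overfull v σ = ⋀-degree v _ σ (λ eq → ℕ.<-irrefl eq (s≤s (size≤N σ)))

  -- `v j` is moved past `v 0`, `v 1`, ... until it meets its own copy, where `wedge-square`
  -- applies.
  ⋀-repeated : ∀ {N} v k j (σ : Vec Bool N) → j < k → wedge (v j) (⋀ v k) σ ≈ 0#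
  ⋀-repeated v (suc k) zero    σ _ = wedge-square (v 0) _ σ
  ⋀-repeated v (suc k) (suc j) σ (s≤s j<k) = begin
    wedge (v (suc j)) (wedge (v 0) (⋀ (v ∘ suc) k)) σ   ≈⟨ wedge-anticomm _ _ _ σ ⟩
    - wedge (v 0) (wedge (v (suc j)) (⋀ (v ∘ suc) k)) σ
      ≈⟨ -‿cong (wedge-zero (v 0) (λ τ → ⋀-repeated (v ∘ suc) k j τ j<k) σ) ⟩
    - 0#                                                ≈⟨ -0#≈0# ⟩
    0#                                                  ∎

  -- Up to the sign (-1)^i, the product of all factors except `v i`, in their order. These forms
  -- arise when the antiderivation rule is carried through the whole product.
  cofactor : ∀ {N} → (ℕ → ℕ → Carrier) → ℕ → ℕ → Form N
  cofactor v zero    i       σ = 0#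
  cofactor v (suc k) zero    σ = ⋀ (v ∘ suc) k σ
  cofactor v (suc k) (suc i) σ = - wedge (v 0) (cofactor (v ∘ suc) k i) σ

  -- Whenever `⋀ v k` vanishes, this becomes a linear relation between the vectors, with cofactors
  -- as coefficients. It is the source both of dependence relations and of Cramer's rule.
  contract-⋀ : ∀ {N} v k j (σ : Vec Bool N) → j < N →
    contract j (⋀ v k) σ ≈ ∑ k (λ i → v i j * cofactor v k i σ)
  contract-⋀ v zero j σ j<N = contract-one j σ
    where
    contract-one : ∀ {N} j (σ : Vec Bool N) → contract j one σ ≈ 0#
    contract-one j       []          = refl
    contract-one zero    (false ∷ σ) = refl
    contract-one zero    (true  ∷ σ) = refl
    contract-one (suc j) (false ∷ σ) = contract-one j σ
    contract-one (suc j) (true  ∷ σ) = trans (-‿cong (contract-zero j (λ _ → refl) σ)) -0#≈0#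
  contract-⋀ v (suc k) j σ j<N = begin
    contract j (wedge (v 0) (⋀ v′ k)) σ
      ≈⟨ contract-wedge j (v 0) _ σ j<N ⟩
    v 0 j * ⋀ v′ k σ - wedge (v 0) (contract j (⋀ v′ k)) σ
      ≈⟨ +-congˡ (-‿cong (trans
           (wedge-cong (v 0) (λ τ → contract-⋀ v′ k j τ j<N) σ)
           (wedge-∑ (v 0) k (λ i → v′ i j) (λ i → cofactor v′ k i) σ))) ⟩
    v 0 j * ⋀ v′ k σ - ∑ k (λ i → v′ i j * wedge (v 0) (cofactor v′ k i) σ)
      ≈⟨ +-congˡ (trans (sym (-1*x≈-x _)) (trans (*-∑ k (- 1#) _) (∑-cong k (λ i _ →
           trans (-1*x≈-x _) (-‿distribʳ-* _ _))))) ⟩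
    ∑ (suc k) (λ i → v i j * cofactor v (suc k) i σ) ∎
    where v′ = v ∘ suc

-- Linear algebra over a field without decidable equality

¬¬-∀< : ∀ {a} {P : ℕ → Set a} n → (∀ i → i < n → ¬ ¬ P i) → ¬ ¬ (∀ i → i < n → P i)
¬¬-∀< zero    h k = k λ _ ()
¬¬-∀< (suc n) h k = h 0 z<s λ p₀ → ¬¬-∀< n (λ i i<n → h (suc i) (s<s i<n)) λ p →
  k λ { zero _ → p₀ ; (suc i) (s≤s i<n) → p i i<n }

¬¬-∀subset : ∀ {a} N {P : Vec Bool N → Set a} → (∀ σ → ¬ ¬ P σ) → ¬ ¬ (∀ σ → P σ)
¬¬-∀subset zero    h k = h [] λ p → k λ { [] → p }
¬¬-∀subset (suc N) h k = ¬¬-∀subset N (h ∘ (false ∷_)) λ p → ¬¬-∀subset N (h ∘ (true ∷_)) λ q →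
  k λ { (false ∷ σ) → p σ ; (true ∷ σ) → q σ }

module Vectors {c ℓ} (A : Field c ℓ) where
  open Field A
  open import Relation.Binary.Reasoning.Setoid setoid
  open RingProperties ring
  open Sums commutativeRing
  open Exterior commutativeRing

  Annihilates : ℕ → (ℕ → ℕ → Carrier) → ℕ → (ℕ → Carrier) → Set ℓ
  Annihilates N v k co = ∀ j → j < N → ∑ k (λ i → co i * v i j) ≈ 0#

  -- Equality in A need not be ¬¬-stable, so this is weaker than linear independence.
  WeaklyIndependent : ℕ → (ℕ → ℕ → Carrier) → ℕ → Set (c ⊔ ℓ)
  WeaklyIndependent N v k = ∀ co → Annihilates N v k co → ∀ i → i < k → ¬ ¬ co i ≈ 0#

  Independent : ℕ → (ℕ → ℕ → Carrier) → ℕ → Set (c ⊔ ℓ)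
  Independent N v k = ∀ co → Annihilates N v k co → ∀ i → i < k → co i ≈ 0#

  -- Were all coefficients zero, the cofactors at each σ would form a relation with leading
  -- coefficient `⋀ (v ∘ suc) k σ`. Weak independence makes it zero up to double negation, for the
  -- finitely many σ simultaneously, against the induction hypothesis for the tail.
  weaklyIndependent⇒⋀≉0 : ∀ N v k → WeaklyIndependent N v k →
    ¬ (∀ (σ : Vec Bool N) → ⋀ v k σ ≈ 0#)
  weaklyIndependent⇒⋀≉0 N v zero wi h =
    0≉1 (trans (sym (h (replicate N false))) (one-empty N))
  weaklyIndependent⇒⋀≉0 N v (suc k) wi h =
    ¬¬-∀subset N (λ σ → wi (λ i → cofactor v (suc k) i σ) (cofactors σ) 0 z<s)
      (weaklyIndependent⇒⋀≉0 N (v ∘ suc) k λ co ann i i<k →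
        wi (0# ◃ co) (λ j j<N → trans (+-congʳ (zeroˡ _)) (trans (+-identityˡ _) (ann j j<N)))
          (suc i) (s<s i<k))
    where
    cofactors : ∀ σ → Annihilates N v (suc k) (λ i → cofactor v (suc k) i σ)
    cofactors σ j j<N = begin
      ∑ (suc k) (λ i → cofactor v (suc k) i σ * v i j) ≈⟨ ∑-cong (suc k) (λ i _ →
        *-comm (cofactor v (suc k) i σ) (v i j)) ⟩
      ∑ (suc k) (λ i → v i j * cofactor v (suc k) i σ) ≈⟨ contract-⋀ v (suc k) j σ j<N ⟨
      contract j (⋀ v (suc k)) σ                       ≈⟨ contract-zero j h σ ⟩
      0#                                               ∎

  overfull-dependent : ∀ N v → ¬ WeaklyIndependent N v (suc N)
  overfull-dependent N v wi = weaklyIndependent⇒⋀≉0 N v (suc N) wi (⋀-overfull v)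

  determinant≉0 : ∀ N v → WeaklyIndependent N v N → ¬ ⋀ {N} v N full ≈ 0#
  determinant≉0 N v wi det≈0 = weaklyIndependent⇒⋀≉0 N v N wi vanishes
    where
    vanishes : ∀ (σ : Vec Bool N) → ⋀ v N σ ≈ 0#
    vanishes σ with size σ ℕ.≟ N
    ... | yes eq rewrite size≡N⇒full σ eq = det≈0
    ... | no  ne = ⋀-degree v N σ ne

  -- Wedging a relation with `⋀ (v ∘ suc) k` leaves only the term of `v 0`, as the others repeat a
  -- factor. The hypothesis, that a scalar killing the form is zero, passes to the tail, unlike the
  -- invertibility of one particular coefficient.
  regular⇒independent : ∀ N v k → (∀ a → (∀ (σ : Vec Bool N) → a * ⋀ v k σ ≈ 0#) → a ≈ 0#) →
    Independent N v k
  regular⇒independent N v (suc k) regular co ann = λ where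
      zero    _         → head≈0
      (suc i) (s≤s i<k) → regular⇒independent N (v ∘ suc) k tail-regular (co ∘ suc) tail-ann i i<k
    where
    ω = ⋀ (v ∘ suc) k
    head≈0 : co 0 ≈ 0#
    head≈0 = regular (co 0) λ σ → let u , eq = wedge-coordinates ω σ in begin
      co 0 * wedge (v 0) ω σ ≈⟨ +-identityʳ _ ⟨
      co 0 * wedge (v 0) ω σ + 0#
        ≈⟨ +-congˡ (∑-zero k (λ i i<k →
             trans (*-congˡ (⋀-repeated (v ∘ suc) k i σ i<k)) (zeroʳ _))) ⟨
      ∑ (suc k) (λ i → co i * wedge (v i) ω σ)
        ≈⟨ ∑-cong (suc k) (λ i _ → trans (*-congˡ {co i} (eq (v i)))
             (trans (*-∑ N (co i) _) (∑-cong N (λ j _ → sym (*-assoc _ _ _))))) ⟩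
      ∑ (suc k) (λ i → ∑ N (λ j → co i * v i j * u j))
        ≈⟨ ∑-swap (suc k) N (λ i j → co i * v i j * u j) ⟩
      ∑ N (λ j → ∑ (suc k) (λ i → co i * v i j * u j))
        ≈⟨ ∑-zero N (λ j j<N → trans (sym (∑-* (suc k) (λ i → co i * v i j) (u j)))
             (trans (*-congʳ (ann j j<N)) (zeroˡ _))) ⟩
      0# ∎
    tail-ann : Annihilates N (v ∘ suc) k (co ∘ suc)
    tail-ann j j<N = trans (sym (trans (+-congʳ (trans (*-congʳ head≈0) (zeroˡ _)))
      (+-identityˡ _))) (ann j j<N)
    tail-regular : ∀ a → (∀ (σ : Vec Bool N) → a * ω σ ≈ 0#) → a ≈ 0#
    tail-regular a h = regular a λ σ →
      trans (sym (wedge-* (v 0) a ω σ)) (wedge-zero (v 0) h σ)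

  unit⇒regular : ∀ {d e} → d * e ≈ 1# → ∀ a → a * d ≈ 0# → a ≈ 0#
  unit⇒regular {d} {e} de≈1 a ad≈0 = begin
    a           ≈⟨ *-identityʳ a ⟨
    a * 1#      ≈⟨ *-congˡ de≈1 ⟨
    a * (d * e) ≈⟨ *-assoc _ _ _ ⟨
    a * d * e   ≈⟨ *-congʳ ad≈0 ⟩
    0# * e      ≈⟨ zeroˡ e ⟩
    0#          ∎

  abstract
    -- The determinant is nonzero, hence a unit, and a unit yields conclusions free of double
    -- negation. For the span, the N + 1 vectors x, v₀, ..., v_(N-1) of length N have zero exterior
    -- product; contracting it gives a relation in which x has the determinant as coefficient.
    weaklyIndependent⇒basis : ∀ N v → WeaklyIndependent N v N →
      Independent N v N ×
      (∀ (x : ℕ → Carrier) → ∃ λ (co : ℕ → Carrier) → ∀ j → j < N → x j ≈ ∑ N (λ i → co i * v i j))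
    weaklyIndependent⇒basis N v wi with d⁻¹ , dd⁻¹≈1 ← inverse _ (determinant≉0 N v wi) =
      regular⇒independent N v N (λ a h → unit⇒regular dd⁻¹≈1 a (h full)) ,
      λ x → (λ i → - d⁻¹ * minor x i) , cramer x
      where
      minor : (ℕ → Carrier) → ℕ → Carrier
      minor x i = cofactor {N} (x ◃ v) (suc N) (suc i) full
      d : Carrier
      d = ⋀ {N} v N full
      cramer : ∀ x j → j < N → x j ≈ ∑ N (λ i → - d⁻¹ * minor x i * v i j)
      cramer x j j<N = begin
        x j                 ≈⟨ *-identityʳ _ ⟨
        x j * 1#            ≈⟨ *-congˡ dd⁻¹≈1 ⟨
        x j * (d * d⁻¹)     ≈⟨ *-assoc _ _ _ ⟨
        x j * d * d⁻¹       ≈⟨ *-congʳ (+-inverseˡ-unique _ _ relation) ⟩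
        - ∑ N (λ i → v i j * minor x i) * d⁻¹ ≈⟨ -‿distribˡ-* _ _ ⟨
        - (∑ N (λ i → v i j * minor x i) * d⁻¹) ≈⟨ -‿distribʳ-* _ _ ⟩
        ∑ N (λ i → v i j * minor x i) * - d⁻¹ ≈⟨ ∑-* N _ _ ⟩
        ∑ N (λ i → v i j * minor x i * - d⁻¹)
          ≈⟨ ∑-cong N (λ i _ → trans (*-comm _ _) (trans (*-congˡ (*-comm _ _)) (sym (*-assoc _ _ _)))) ⟩
        ∑ N (λ i → - d⁻¹ * minor x i * v i j) ∎
        where
        relation : x j * d + ∑ N (λ i → v i j * minor x i) ≈ 0#
        relation = trans (sym (contract-⋀ (x ◃ v) (suc N) j full j<N))
          (contract-zero {N} j (⋀-overfull (x ◃ v)) full)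

    -- u is the vector of maximal minors of v.
    hyperplane : ∀ N v → ∃ λ (u : ℕ → Carrier) →
      (∀ x → WeaklyIndependent (suc N) (x ◃ v) (suc N) → ¬ ∑ (suc N) (λ j → x j * u j) ≈ 0#) ×
      (∀ x → ∑ (suc N) (λ j → x j * u j) ≈ 1# → Independent (suc N) (x ◃ v) (suc N))
    hyperplane N v with u , eq ← wedge-coordinates {suc N} (⋀ v N) full =
      u ,
      (λ x wi xu≈0 → determinant≉0 (suc N) (x ◃ v) wi (trans (eq x) xu≈0)) ,
      (λ x xu≈1 → regular⇒independent (suc N) (x ◃ v) (suc N) λ a h →
        trans (sym (*-identityʳ a)) (trans (*-congˡ (sym (trans (eq x) xu≈1))) (h full)))

-- Bases of subspaces over a subfield

module Linear {c ℓ} (L : Field c ℓ) where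
  open Field L hiding (zero)
  open import Relation.Binary.Reasoning.Setoid setoid
  open RingProperties ring using
    (-1*x≈-x; +-inverseˡ-unique; x∙y⁻¹≈ε⇒x≈y; [y-z]x≈yx-zx)
  open Sums commutativeRing

  module _ {p} (S : Pred Carrier p) where

    Combination : ℕ → (ℕ → Carrier) → Pred Carrier (c ⊔ ℓ ⊔ p)
    Combination n w x = ∃ λ (co : ℕ → Carrier) → (∀ i → S (co i)) × x ≈ ∑ n (λ i → co i * w i)

    WeaklyIndependent : ℕ → (ℕ → Carrier) → Set (c ⊔ ℓ ⊔ p)
    WeaklyIndependent n w = ∀ (co : ℕ → Carrier) → (∀ i → S (co i)) → ∑ n (λ i → co i * w i) ≈ 0# →
      ∀ i → i < n → ¬ ¬ co i ≈ 0#

    Independent : ℕ → (ℕ → Carrier) → Set (c ⊔ ℓ ⊔ p)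
    Independent n w = ∀ (co : ℕ → Carrier) → (∀ i → S (co i)) → ∑ n (λ i → co i * w i) ≈ 0# →
      ∀ i → i < n → co i ≈ 0#

    record IsBasis {q} (V : Pred Carrier q) (n : ℕ) (w : ℕ → Carrier) : Set (c ⊔ ℓ ⊔ p ⊔ q) where
      field
        mem   : ∀ i → i < n → V (w i)
        indep : Independent n w
        span  : ∀ {x} → V x → Combination n w x

  -- A `Combination` asks for coefficients in `S` at every natural number, also beyond its length.
  -- Filling up with zeros provides these and lets a combination be lengthened without changing its
  -- value.
  truncate : ℕ → (ℕ → Carrier) → ℕ → Carrier
  truncate zero    f i       = 0#
  truncate (suc n) f zero    = f zero
  truncate (suc n) f (suc i) = truncate n (f ∘ suc) i

  truncate-< : ∀ n f i → i < n → truncate n f i ≡ f i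
  truncate-< (suc n) f zero    _         = ≡.refl
  truncate-< (suc n) f (suc i) (s≤s i<n) = truncate-< n (f ∘ suc) i i<n

  truncate-all : ∀ {q} (V : Pred Carrier q) → V 0# → ∀ n f → (∀ i → i < n → V (f i)) →
    ∀ i → V (truncate n f i)
  truncate-all V V0 zero    f Vf i       = V0
  truncate-all V V0 (suc n) f Vf zero    = Vf 0 z<s
  truncate-all V V0 (suc n) f Vf (suc i) =
    truncate-all V V0 n (f ∘ suc) (λ j j<n → Vf (suc j) (s<s j<n)) i

  ∑-truncate : ∀ m n (f w : ℕ → Carrier) → m ≤ n →
    ∑ n (λ i → truncate m f i * w i) ≈ ∑ m (λ i → f i * w i)
  ∑-truncate zero    n       f w _         = ∑-zero n (λ i _ → zeroˡ (w i))
  ∑-truncate (suc m) (suc n) f w (s≤s m≤n) = +-congˡ (∑-truncate m n (f ∘ suc) (w ∘ suc) m≤n)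

  module Over {p} {S : Pred Carrier p} (isS : IsSubfield L S) where
    private module S = IsSubfield isS

    -- The coefficients given by Cramer's rule must lie in `S`, so determinants are formed in `S` as
    -- a field of its own. Its elements are compared in L, whatever their membership proofs.
    subfield : Field (c ⊔ p) ℓ
    subfield = record
      { commutativeRing = record
        { isCommutativeRing = RingMonomorphism.isCommutativeRing inclusion isCommutativeRing }
      ; 0≉1 = 0≉1
      ; inverse = λ x x≉0 → let y , xy≈1 = inverse (proj₁ x) x≉0 in
          (y , S.inv-cl (proj₂ x) xy≈1) , xy≈1
      }
      where
      subring : RawRing (c ⊔ p) ℓ
      subring = record
        { Carrier = Σ Carrier S
        ; _≈_ = λ x y → proj₁ x ≈ proj₁ y
        ; _+_ = λ x y → proj₁ x + proj₁ y , S.+-cl (proj₂ x) (proj₂ y)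
        ; _*_ = λ x y → proj₁ x * proj₁ y , S.*-cl (proj₂ x) (proj₂ y)
        ; -_ = λ x → - proj₁ x , S.neg-cl (proj₂ x)
        ; 0# = 0# , S.has0
        ; 1# = 1# , S.has1
        }
      inclusion : IsRingMonomorphism subring (Ring.rawRing ring) proj₁
      inclusion = record
        { isRingHomomorphism = record
          { isSemiringHomomorphism = record
            { isNearSemiringHomomorphism = record
              { +-isMonoidHomomorphism = record
                { isMagmaHomomorphism = record
                  { isRelHomomorphism = record { cong = id }
                  ; homo = λ _ _ → refl }
                ; ε-homo = refl }
              ; *-homo = λ _ _ → refl }
            ; 1#-homo = refl }
          ; -‿homo = λ _ → refl }
        ; injective = id }

    private
      Ŝ = Field.Carrier subfield
      module Ŝ = Sums (Field.commutativeRing subfield)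
      module V̂ = Vectors subfield

    proj₁-∑ : ∀ n f → proj₁ (Ŝ.∑ n f) ≡ ∑ n (proj₁ ∘ f)
    proj₁-∑ zero    f = ≡.refl
    proj₁-∑ (suc n) f = ≡.cong (_ +_) (proj₁-∑ n (f ∘ suc))

    selfSubspace : IsSubspace L S S
    selfSubspace = record { resp = S.resp ; has0 = S.has0 ; +-cl = S.+-cl ; smul = S.*-cl }

    module Subspace {q} {V : Pred Carrier q} (isV : IsSubspace L S V) where
      open IsSubspace isV public

      neg : ∀ {x} → V x → V (- x)
      neg Vx = resp (-1*x≈-x _) (smul (S.neg-cl S.has1) Vx)

      ∑-mem : ∀ n {f} → (∀ i → i < n → V (f i)) → V (∑ n f)
      ∑-mem zero    Vf = has0
      ∑-mem (suc n) Vf = +-cl (Vf 0 z<s) (∑-mem n (λ i i<n → Vf (suc i) (s<s i<n)))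

      combination-mem : ∀ n {w x} → (∀ i → i < n → V (w i)) → Combination S n w x → V x
      combination-mem n Vw (co , Sco , x≈) =
        resp (sym x≈) (∑-mem n (λ i i<n → smul (Sco i) (Vw i i<n)))

      divide : ∀ {a x} → S a → ¬ a ≈ 0# → V (a * x) → V x
      divide {a} {x} Sa a≉0 Vax with a⁻¹ , aa⁻¹≈1 ← inverse a a≉0 =
        resp (begin
          a⁻¹ * (a * x) ≈⟨ *-assoc _ _ _ ⟨
          a⁻¹ * a * x   ≈⟨ *-congʳ (trans (*-comm _ _) aa⁻¹≈1) ⟩
          1# * x        ≈⟨ *-identityˡ x ⟩
          x             ∎) (smul (S.inv-cl Sa aa⁻¹≈1) Vax)

      solve : ∀ {a x y} → S a → ¬ a ≈ 0# → a * x + y ≈ 0# → V y → V x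
      solve Sa a≉0 ax+y≈0 Vy = divide Sa a≉0 (resp (sym (+-inverseˡ-unique _ _ ax+y≈0)) (neg Vy))

    combination-subspace : ∀ n w → IsSubspace L S (Combination S n w)
    combination-subspace n w = record
      { resp = λ x≈y → λ (co , Sco , x≈) → co , Sco , trans (sym x≈y) x≈
      ; has0 = (λ _ → 0#) , (λ _ → S.has0) , sym (∑-zero n (λ i _ → zeroˡ (w i)))
      ; +-cl = λ (a , Sa , x≈) (b , Sb , y≈) →
          (λ i → a i + b i) , (λ i → S.+-cl (Sa i) (Sb i)) ,
          trans (+-cong x≈ y≈) (trans (sym (∑-+ n _ _)) (∑-cong n (λ i _ → sym (distribʳ (w i) (a i) (b i)))))
      ; smul = λ {k} Sk → λ (a , Sa , x≈) →
          (λ i → k * a i) , (λ i → S.*-cl Sk (Sa i)) ,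
          trans (*-congˡ x≈) (trans (*-∑ n k _) (∑-cong n (λ i _ → sym (*-assoc k (a i) (w i)))))
      }

    generator : ∀ n w i → i < n → Combination S n w (w i)
    generator n w i i<n = indicator i , indicator-S i , sym (∑-indicator n i w i<n)
      where
      indicator-S : ∀ i j → S (indicator i j)
      indicator-S zero    zero    = S.has1
      indicator-S zero    (suc j) = S.has0
      indicator-S (suc i) zero    = S.has0
      indicator-S (suc i) (suc j) = indicator-S i j

    combination-mono : ∀ {m n w x} → m ≤ n → Combination S m w x → Combination S n w x
    combination-mono {m} {n} {w} m≤n (co , Sco , x≈) =
      truncate m co , truncate-all S S.has0 m co (λ i _ → Sco i) ,
      trans x≈ (sym (∑-truncate m n co w m≤n))

    independent-≤ : ∀ {m n w} → m ≤ n → Independent S n w → Independent S m w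
    independent-≤ {m} {n} {w} m≤n ind co Sco eq i i<m =
      trans (reflexive (≡.sym (truncate-< m co i i<m)))
        (ind (truncate m co) (truncate-all S S.has0 m co (λ j _ → Sco j))
          (trans (∑-truncate m n co w m≤n) eq) i (ℕ.<-≤-trans i<m m≤n))

    weaken : ∀ {n w} → Independent S n w → WeaklyIndependent S n w
    weaken ind co Sco eq i i<n k = k (ind co Sco eq i i<n)

    coefficients-unique : ∀ {n w} → Independent S n w → ∀ {a b : ℕ → Carrier} →
      (∀ i → S (a i)) → (∀ i → S (b i)) →
      ∑ n (λ i → a i * w i) ≈ ∑ n (λ i → b i * w i) → ∀ i → i < n → a i ≈ b i
    coefficients-unique {n} {w} ind {a} {b} Sa Sb eq i i<n = x∙y⁻¹≈ε⇒x≈y _ _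
      (ind (λ i → a i - b i) (λ i → S.+-cl (Sa i) (S.neg-cl (Sb i))) (begin
        ∑ n (λ i → (a i - b i) * w i) ≈⟨ ∑-cong n (λ i _ → [y-z]x≈yx-zx (w i) (a i) (b i)) ⟩
        ∑ n (λ i → a i * w i - b i * w i)
          ≈⟨ ∑-cong n (λ i _ → +-congˡ (sym (-1*x≈-x (b i * w i)))) ⟩
        ∑ n (λ i → a i * w i + - 1# * (b i * w i)) ≈⟨ ∑-+ n _ _ ⟩
        ∑ n (λ i → a i * w i) + ∑ n (λ i → - 1# * (b i * w i)) ≈⟨ +-congˡ (*-∑ n (- 1#) _) ⟨
        ∑ n (λ i → a i * w i) + - 1# * ∑ n (λ i → b i * w i)
          ≈⟨ +-cong eq (-1*x≈-x _) ⟩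
        ∑ n (λ i → b i * w i) - ∑ n (λ i → b i * w i) ≈⟨ -‿inverseʳ _ ⟩
        0# ∎) i i<n)

    -- Coordinate matrices over the subfield.

    record Coordinates (N : ℕ) (g : ℕ → Carrier) (k : ℕ) (w : ℕ → Carrier) (M : ℕ → ℕ → Ŝ) :
        Set ℓ where
      constructor rows
      field row : ∀ i → i < k → w i ≈ ∑ N (λ j → proj₁ (M i j) * g j)

    -- Built by recursion, as combinations are given only for i < k while `M` has to be total; the
    -- remaining rows are zero.
    coordinates : ∀ N g k w → (∀ i → i < k → Combination S N g (w i)) →
      ∃ λ M → Coordinates N g k w M
    coordinates N g zero    w comb = (λ _ _ → 0# , S.has0) , rows λ _ ()
    coordinates N g (suc k) w comb
      with co , Sco , eq ← comb 0 z<s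
         | M , rows eqs ← coordinates N g k (w ∘ suc) (λ i i<k → comb (suc i) (s<s i<k)) =
      ((λ j → co j , Sco j) ◃ M) , rows λ { zero _ → eq ; (suc i) (s≤s i<k) → eqs i i<k }

    ∑-coordinates : ∀ {N g k w M} → Coordinates N g k w M → ∀ (co : ℕ → Carrier) →
      ∑ k (λ i → co i * w i) ≈ ∑ N (λ j → ∑ k (λ i → co i * proj₁ (M i j)) * g j)
    ∑-coordinates {N} {g} {k} {w} {M} (rows eqs) co = begin
      ∑ k (λ i → co i * w i)
        ≈⟨ ∑-cong k (λ i i<k → trans (*-congˡ (eqs i i<k)) (trans (*-∑ N _ _)
             (∑-cong N (λ j _ → sym (*-assoc (co i) (proj₁ (M i j)) (g j)))))) ⟩
      ∑ k (λ i → ∑ N (λ j → co i * proj₁ (M i j) * g j))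
        ≈⟨ ∑-swap k N (λ i j → co i * proj₁ (M i j) * g j) ⟩
      ∑ N (λ j → ∑ k (λ i → co i * proj₁ (M i j) * g j))
        ≈⟨ ∑-cong N (λ j _ → sym (∑-* k (λ i → co i * proj₁ (M i j)) (g j))) ⟩
      ∑ N (λ j → ∑ k (λ i → co i * proj₁ (M i j)) * g j) ∎

    coordinates-weaklyIndependent : ∀ {N g k w M} → Coordinates N g k w M →
      WeaklyIndependent S k w → V̂.WeaklyIndependent N M k
    coordinates-weaklyIndependent {N} {g} {k} {w} {M} eqs wi co ann =
      wi (proj₁ ∘ co) (proj₂ ∘ co) (trans (∑-coordinates eqs (proj₁ ∘ co))
        (∑-zero N (λ j j<N → trans (*-congʳ (trans
          (reflexive (≡.sym (proj₁-∑ k _))) (ann j j<N))) (zeroˡ (g j)))))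

    coordinates-independent : ∀ {N g k w M} → Coordinates N g k w M →
      Independent S N g → V̂.Independent N M k → Independent S k w
    coordinates-independent {N} {g} {k} {w} {M} eqs gind Mind co Sco eq =
      Mind (λ i → co i , Sco i) (λ j j<N → trans (reflexive (proj₁-∑ k _))
        (gind (λ j → ∑ k (λ i → co i * proj₁ (M i j)))
          (λ j → ∑-mem k {λ i → co i * proj₁ (M i j)} (λ i _ → S.*-cl (Sco i) (proj₂ (M i j))))
          (trans (sym (∑-coordinates eqs co)) eq) j j<N))
      where open Subspace selfSubspace

    overspanned-dependent : ∀ {N g w} → (∀ i → i < suc N → Combination S N g (w i)) →
      ¬ WeaklyIndependent S (suc N) w
    overspanned-dependent {N} {g} {w} comb wi with M , eqs ← coordinates N g (suc N) w comb =
      V̂.overfull-dependent N M (coordinates-weaklyIndependent eqs wi)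

    -- In coordinates with respect to `b`, the family `w` is a square matrix over `S` with
    -- invertible determinant. Negative knowledge about a family whose length matches the dimension
    -- thus becomes a genuine basis.
    weaklyIndependent⇒basis : ∀ {q} {V : Pred Carrier q} {N b w} → IsBasis S V N b →
      (∀ i → i < N → V (w i)) → WeaklyIndependent S N w → IsBasis S V N w
    weaklyIndependent⇒basis {V = V} {N} {b} {w} isB Vw wi
      with M , eqs ← coordinates N b N w (λ i i<N → IsBasis.span isB (Vw i i<N))
      with Mind , Mspan ← V̂.weaklyIndependent⇒basis N M
             (coordinates-weaklyIndependent eqs wi) = record
      { mem   = Vw
      ; indep = coordinates-independent eqs B.indep Mind
      ; span  = λ {x} Vx →
          let X , SX , x≈ = B.span Vx
              co , eq     = Mspan (λ j → X j , SX j) in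
          proj₁ ∘ co , proj₂ ∘ co , (begin
            x                     ≈⟨ x≈ ⟩
            ∑ N (λ j → X j * b j) ≈⟨ ∑-cong N (λ j j<N → *-congʳ (trans (eq j j<N)
                                       (reflexive (proj₁-∑ N _)))) ⟩
            ∑ N (λ j → ∑ N (λ i → proj₁ (co i) * proj₁ (M i j)) * b j)
                                  ≈⟨ ∑-coordinates eqs (proj₁ ∘ co) ⟨
            ∑ N (λ i → proj₁ (co i) * w i) ∎)
      }
      where module B = IsBasis isB

    -- If the coefficient of `x` were nonzero, dividing by it would put `x` into `V`. As the goal is
    -- negative, that coefficient may then be taken to be zero, which leaves a relation on `w`.
    cons-weaklyIndependent : ∀ {q} {V : Pred Carrier q} → IsSubspace L S V → ∀ {k w x} →
      WeaklyIndependent S k w → (∀ i → i < k → V (w i)) → ¬ V x →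
      WeaklyIndependent S (suc k) (x ◃ w)
    cons-weaklyIndependent isV {k} {w} {x} wi Vw ¬Vx co Sco eq = λ where
        zero    _         → head
        (suc i) (s≤s i<k) → λ ¬z → head λ co0≈0 → wi (co ∘ suc) (Sco ∘ suc)
          (trans (sym (trans (+-congʳ (trans (*-congʳ co0≈0) (zeroˡ x))) (+-identityˡ _))) eq) i i<k ¬z
      where
      open Subspace isV
      head : ¬ ¬ co 0 ≈ 0#
      head co0≉0 = ¬Vx (solve (Sco 0) co0≉0 eq
        (∑-mem k (λ i i<k → smul (Sco (suc i)) (Vw i i<k))))

    snoc-weaklyIndependent : ∀ {q} {V : Pred Carrier q} → IsSubspace L S V → ∀ {k w} →
      WeaklyIndependent S k w → (∀ i → i < k → V (w i)) → ¬ V (w k) →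
      WeaklyIndependent S (suc k) w
    snoc-weaklyIndependent isV {k} {w} wi Vw ¬Vx co Sco eq i i<1+k ¬z =
      last λ cok≈0 → case-≤ (ℕ.m≤n⇒m<n∨m≡n (s≤s⁻¹ i<1+k)) cok≈0
      where
      open Subspace isV
      eq′ : co k * w k + ∑ k (λ i → co i * w i) ≈ 0#
      eq′ = trans (+-comm _ _) (trans (sym (∑-last k (λ i → co i * w i))) eq)
      last : ¬ ¬ co k ≈ 0#
      last cok≉0 = ¬Vx (solve (Sco k) cok≉0 eq′ (∑-mem k (λ i i<k → smul (Sco i) (Vw i i<k))))
      case-≤ : i < k ⊎ i ≡ k → co k ≈ 0# → ⊥
      case-≤ (inj₂ ≡.refl) cok≈0 = ¬z cok≈0
      case-≤ (inj₁ i<k)    cok≈0 = wi co Sco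
        (trans (sym (trans (+-congʳ (trans (*-congʳ cok≈0) (zeroˡ _))) (+-identityˡ _))) eq′) i i<k ¬z

    -- ∑ uᵢbᵢ is a nonzero element of L; expressing its inverse in the basis b turns the
    -- nonvanishing of u, a negative statement, into a unimodularity relation over S.
    unimodular : ∀ {q} {V : Pred Carrier q} {n b} → IsBasis S V n b → (∀ x → V x) → 0 < n →
      ∀ {k} → k ≤ n → ∀ (u : ℕ → Carrier) → (∀ i → S (u i)) → ¬ (∀ i → i < k → u i ≈ 0#) →
      ∃ λ (w : ℕ → Carrier) → (∀ i → S (w i)) × ∑ k (λ i → w i * u i) ≈ 1#
    unimodular {n = n} {b = b} isB total 0<n {k} k≤n u Su u≉0
      with y , xy≈1 ← inverse (∑ k (λ i → u i * b i))
             (λ x≈0 → u≉0 (independent-≤ k≤n (IsBasis.indep isB) u Su x≈0))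
      -- The factor `b 0` makes the sum a basis vector: ∑ uᵢbᵢ · y · b₀ = b₀ has coordinate 1 at
      -- index 0, whereas the coordinates of `1#` in `b` are not known.
      with M , eqs ← coordinates n b k (λ i → b i * (y * b 0)) (λ i _ → IsBasis.span isB (total _)) =
      (λ i → proj₁ (M i 0)) , (λ i → proj₂ (M i 0)) , (begin
        ∑ k (λ i → proj₁ (M i 0) * u i) ≈⟨ ∑-cong k (λ i _ → *-comm _ _) ⟩
        ∑ k (λ i → u i * proj₁ (M i 0)) ≈⟨ coefficients-unique (IsBasis.indep isB)
          {λ j → ∑ k (λ i → u i * proj₁ (M i j))} {proj₁ gen}
          (λ j → ∑-mem k {λ i → u i * proj₁ (M i j)} (λ i _ → S.*-cl (Su i) (proj₂ (M i j)))) (proj₁ (proj₂ gen)) (begin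
            ∑ n (λ j → ∑ k (λ i → u i * proj₁ (M i j)) * b j) ≈⟨ ∑-coordinates eqs u ⟨
            ∑ k (λ i → u i * (b i * (y * b 0))) ≈⟨ ∑-cong k (λ i _ → *-assoc (u i) (b i) _) ⟨
            ∑ k (λ i → u i * b i * (y * b 0)) ≈⟨ ∑-* k _ _ ⟨
            ∑ k (λ i → u i * b i) * (y * b 0) ≈⟨ *-assoc _ y (b 0) ⟨
            ∑ k (λ i → u i * b i) * y * b 0   ≈⟨ *-congʳ xy≈1 ⟩
            1# * b 0                          ≈⟨ *-identityˡ _ ⟩
            b 0                               ≈⟨ proj₂ (proj₂ gen) ⟩
            ∑ n (λ j → indicator 0 j * b j)   ∎) 0 0<n ⟩
        1# ∎)
      where
      open Subspace selfSubspace
      gen : Combination S n b (b 0)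
      gen = generator n b 0 0<n

    -- By `hyperplane`, the determinant of x followed by `e`, in coordinates `g`, is a linear form
    -- in x with vector `u`. If `u` vanished, every `g j` would lie in `E` up to double negation,
    -- giving N + 1 independent vectors spanned by N. So `unimodular` finds coefficients at which
    -- the form is 1, and these define α.
    complete-basis : ∀ {p′ q r} {A : Pred Carrier p′} {V : Pred Carrier q} {E : Pred Carrier r}
      {n b N g e} →
      IsBasis S A n b → (∀ x → A x) → suc N ≤ n → IsSubspace L S V → IsBasis S V (suc N) g →
      IsSubspace L S E → IsBasis S E N e → E ⊆ V →
      ∃ λ α → V α × IsBasis S V (suc N) (α ◃ e)
    complete-basis {V = V} {E} {n} {N = N} {g} {e} isA total N<n isV isG isE isE′ E⊆V =
      α , Vα , weaklyIndependent⇒basis isG V-family (weaken {w = α ◃ e} αe-indep)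
      where
      module E = IsBasis isE′
      module G = IsBasis isG
      open Subspace isV using (combination-mem)
      e-coordinates : ∃ λ M → Coordinates (suc N) g N e M
      e-coordinates = coordinates (suc N) g N e (λ i i<N → G.span (E⊆V (E.mem i i<N)))
      M   = proj₁ e-coordinates
      hyp = V̂.hyperplane N M
      û : ℕ → Ŝ
      û = proj₁ hyp
      u : ℕ → Carrier
      u = proj₁ ∘ û
      proj₁-∑-û : ∀ (X : ℕ → Ŝ) →
        proj₁ (Ŝ.∑ (suc N) (λ j → Field._*_ subfield (X j) (û j))) ≈
        ∑ (suc N) (λ j → proj₁ (X j) * u j)
      proj₁-∑-û X = reflexive (proj₁-∑ (suc N) (λ j → Field._*_ subfield (X j) (û j)))
      cons-coordinates : ∀ {x} (X : ℕ → Ŝ) → x ≈ ∑ (suc N) (λ j → proj₁ (X j) * g j) →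
        Coordinates (suc N) g (suc N) (x ◃ e) (X ◃ M)
      cons-coordinates X x≈ = rows λ where
        zero    _         → x≈
        (suc i) (s≤s i<N) → Coordinates.row (proj₂ e-coordinates) i i<N
      outside : ∀ j → j < suc N → ¬ E (g j) → ¬ u j ≈ 0#
      outside j j<1+N ¬Egj uj≈0 = proj₁ (proj₂ hyp) X
        (coordinates-weaklyIndependent (cons-coordinates X (proj₂ (proj₂ gen)))
          (cons-weaklyIndependent isE (weaken E.indep) E.mem ¬Egj))
        (trans (proj₁-∑-û X) (trans (∑-indicator (suc N) j u j<1+N) uj≈0))
        where
        gen = generator (suc N) g j j<1+N
        X : ℕ → Ŝ
        X i = proj₁ gen i , proj₁ (proj₂ gen) i
      u≉0 : ¬ (∀ j → j < suc N → u j ≈ 0#)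
      u≉0 u≈0 = ¬¬-∀< {P = λ j → E (g j)} (suc N)
        (λ j j<1+N ¬Egj → outside j j<1+N ¬Egj (u≈0 j j<1+N))
        λ Eg → overspanned-dependent (λ i i<1+N → E.span (Eg i i<1+N)) (weaken {w = g} G.indep)
      uni = unimodular isA total (ℕ.<-≤-trans z<s N<n) N<n u (proj₂ ∘ û) u≉0
      X : ℕ → Ŝ
      X j = proj₁ uni j , proj₁ (proj₂ uni) j
      α = ∑ (suc N) (λ j → proj₁ (X j) * g j)
      Vα : V α
      Vα = combination-mem (suc N) G.mem (proj₁ ∘ X , proj₂ ∘ X , refl)
      αe-indep : Independent S (suc N) (α ◃ e)
      αe-indep = coordinates-independent (cons-coordinates X refl) G.indep
        (proj₂ (proj₂ hyp) X (trans (proj₁-∑-û X) (proj₂ (proj₂ uni))))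
      V-family : ∀ i → i < suc N → V ((α ◃ e) i)
      V-family zero    _         = Vα
      V-family (suc i) (s≤s i<N) = E⊆V (E.mem i i<N)

-- Mixed radix digits

module _ (N : ℕ) .{{_ : NonZero N}} where

  [i+lN]%N≡i : ∀ {i} l → i < N → (i +ℕ l *ℕ N) % N ≡ i
  [i+lN]%N≡i {i} l i<N = ≡.trans ([m+kn]%n≡m%n i l N) (m<n⇒m%n≡m i<N)

  [i+lN]/N≡l : ∀ {i} l → i < N → (i +ℕ l *ℕ N) / N ≡ l
  [i+lN]/N≡l {i} l i<N = ≡.trans (+-distrib-/ i (l *ℕ N) (≡.subst (_< N)
    (≡.sym (≡.trans (≡.cong₂ _+ℕ_ (m<n⇒m%n≡m i<N) (m*n%n≡0 l N)) (ℕ.+-identityʳ i))) i<N))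
    (≡.cong₂ _+ℕ_ (m<n⇒m/n≡0 i<N) (m*n/n≡m l N))

  i+lN<jN : ∀ {i l j} → i < N → l < j → i +ℕ l *ℕ N < j *ℕ N
  i+lN<jN {l = l} i<N l<j = ℕ.<-≤-trans (ℕ.+-monoˡ-< (l *ℕ N) i<N) (ℕ.*-monoˡ-≤ N l<j)

  m/N<j⇒m<jN : ∀ {m j} → m / N < j → m < j *ℕ N
  m/N<j⇒m<jN {m} m/N<j =
    ≡.subst (_< _) (≡.sym (m≡m%n+[m/n]*n m N)) (i+lN<jN (m%n<n m N) m/N<j)

  digitwise-+ : ∀ a b q r → (a +ℕ q *ℕ N) +ℕ (b +ℕ r *ℕ N) ≡ (a +ℕ b) +ℕ (q +ℕ r) *ℕ N
  digitwise-+ a b q r = ≡.trans (interchange a (q *ℕ N) b (r *ℕ N))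
    (≡.cong (a +ℕ b +ℕ_) (≡.sym (ℕ.*-distribʳ-+ N q r)))
    where open CommutativeSemigroupProperties ℕ.+-commutativeSemigroup using (interchange)

  m+n≡%+/ : ∀ m n → m +ℕ n ≡ (m % N +ℕ n % N) +ℕ (m / N +ℕ n / N) *ℕ N
  m+n≡%+/ m n = ≡.trans (≡.cong₂ _+ℕ_ (m≡m%n+[m/n]*n m N) (m≡m%n+[m/n]*n n N))
    (digitwise-+ (m % N) (n % N) (m / N) (n / N))

-- The index of the product v_a v_b in H.
index : List ℕ → ℕ → ℕ → ℕ
index []       a b = 0
index (m ∷ ms) a b = (a % d +ℕ b % d) % d +ℕ index ms (a / d) (b / d) *ℕ d
  where d = suc (m ∸ 1)

digits-index : ∀ ns a b → digits ns (index ns a b) ≡ mulH ns (digits ns a) (digits ns b)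
digits-index []       a b = ≡.refl
digits-index (m ∷ ms) a b = ≡.cong₂ _∷_
  ([i+lN]%N≡i d (index ms (a / d) (b / d)) (m%n<n (a % d +ℕ b % d) d))
  (≡.trans (≡.cong (digits ms) ([i+lN]/N≡l d (index ms (a / d) (b / d)) (m%n<n (a % d +ℕ b % d) d)))
    (digits-index ms (a / d) (b / d)))
  where d = suc (m ∸ 1)

product-nonZero : ∀ {ns} → All (1 <_) ns → NonZero (product ns)
product-nonZero []                  = _
product-nonZero (s≤s {n = m} _ ∷ 1<ms) = ℕ.m*n≢0 (suc m) _ {{_}} {{product-nonZero 1<ms}}

/-<product : ∀ {m} ms {a} .{{_ : NonZero m}} → a < product (m ∷ ms) → a / m < product ms
/-<product {m} ms {a} a<n = m<n*o⇒m/o<n (≡.subst (a <_) (ℕ.*-comm m (product ms)) a<n)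

digits-injective : ∀ {ns} → All (1 <_) ns → ∀ {a b} → a < product ns → b < product ns →
  digits ns a ≡ digits ns b → a ≡ b
digits-injective [] {zero} {zero} _ _ _ = ≡.refl
digits-injective [] {suc _} (s≤s ()) _ _
digits-injective [] {zero} {suc _} _ (s≤s ()) _
digits-injective {m ∷ ms} (s≤s (s≤s z≤n) ∷ 1<ms) {a} {b} a<n b<n eq =
  ≡.trans (m≡m%n+[m/n]*n a m) (≡.trans (≡.cong₂ (λ r q → r +ℕ q *ℕ m)
    (proj₁ (List.∷-injective eq))
    (digits-injective 1<ms (/-<product ms a<n) (/-<product ms b<n) (proj₂ (List.∷-injective eq))))
    (≡.sym (m≡m%n+[m/n]*n b m)))

index<product : ∀ {ns} → All (1 <_) ns → ∀ a b → index ns a b < product ns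
index<product []                                a b = s≤s z≤n
index<product {m ∷ ms} (s≤s (s≤s z≤n) ∷ 1<ms) a b =
  ≡.subst (index (m ∷ ms) a b <_) (ℕ.*-comm (product ms) m)
    (i+lN<jN m (m%n<n (a % m +ℕ b % m) m) (index<product 1<ms (a / m) (b / m)))

-- `ProdSubH` without its existential quantifier: a finite comparison of numbers, hence decidable,
-- so that least values can be searched for.
IndexBound : List ℕ → ℕ → ℕ → ℕ → Set
IndexBound ns i j k = ∀ a b → a ≤ i → b ≤ j → index ns a b ≤ k

indexBound⇒prodSubH : ∀ ns {i j k} → IndexBound ns i j k → ProdSubH ns i j k
indexBound⇒prodSubH ns bound a b a≤i b≤j = index ns a b , bound a b a≤i b≤j , digits-index ns a b

prodSubH⇒indexBound : ∀ {ns} → All (1 <_) ns → ∀ {i j k} → k < product ns →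
  ProdSubH ns i j k → IndexBound ns i j k
prodSubH⇒indexBound {ns} 1<ns k<n sub a b a≤i b≤j with c , c≤k , eq ← sub a b a≤i b≤j =
  ≡.subst (_≤ _) (digits-injective 1<ns (ℕ.≤-<-trans c≤k k<n) (index<product 1<ns a b)
    (≡.trans eq (≡.sym (digits-index ns a b)))) c≤k

indexBound? : ∀ ns i j k → Dec (IndexBound ns i j k)
indexBound? ns i j k = map′
  (λ h a b a≤i b≤j → h (s≤s a≤i) (s≤s b≤j))
  (λ h {a} a≤i {b} b≤j → h a b (s≤s⁻¹ a≤i) (s≤s⁻¹ b≤j))
  (ℕ.allUpTo? (λ a → ℕ.allUpTo? (λ b → index ns a b ℕ.≤? k) (suc j)) (suc i))

least : ∀ {P : ℕ → Set} → (∀ k → Dec (P k)) → ∀ k → P k →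
  ∃ λ k₀ → k₀ ≤ k × P k₀ × (∀ k′ → k′ < k₀ → ¬ P k′)
least P? zero    p = 0 , z≤n , p , λ _ ()
least P? (suc k) p with P? 0
... | yes p₀ = 0 , z≤n , p₀ , λ _ ()
... | no ¬p₀ with k₀ , k₀≤k , pk₀ , min ← least (P? ∘ suc) k p =
  suc k₀ , s≤s k₀≤k , pk₀ , λ { zero _ → ¬p₀ ; (suc k′) (s≤s k′<k₀) → min k′ k′<k₀ }

towerType : ∀ {ns} → All (1 <_) ns → ∀ i j →
  ∃ λ k → k < product ns × IndexBound ns i j k × (∀ k′ → k′ < k → ¬ IndexBound ns i j k′) ×
    TowerTypeIs ns i j k
-- The product is named `n` so that it can be matched as a successor: every index is at most the
-- predecessor, which bounds the search.
towerType {ns} 1<ns i j = below (product ns) ≡.refl (index<product 1<ns)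
  where
  below : ∀ n → product ns ≡ n → (∀ a b → index ns a b < n) → ∃ λ k → k < n ×
    IndexBound ns i j k × (∀ k′ → k′ < k → ¬ IndexBound ns i j k′) × TowerTypeIs ns i j k
  below zero    _  index<n with () ← index<n 0 0
  below (suc n) eq index<n
    with k , k≤n , bound , min ← least (indexBound? ns i j) n (λ a b _ _ → s≤s⁻¹ (index<n a b)) =
    k , s≤s k≤n , bound , min , indexBound⇒prodSubH ns bound , λ k′ k′<k sub →
      min k′ k′<k (prodSubH⇒indexBound 1<ns (≡.subst (k′ <_) (≡.sym eq)
        (ℕ.<-trans k′<k (s≤s k≤n))) sub)

-- Carries in mixed radix addition.

NoCarry : List ℕ → ℕ → ℕ → Set
NoCarry []       a b = ⊤
NoCarry (m ∷ ms) a b = a % d +ℕ b % d < d × NoCarry ms (a / d) (b / d)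
  where d = suc (m ∸ 1)

-- Carry ns a b k: the addition of a and b produces a carry, and k arises from a + b by
-- dropping the carries and filling all digits up to the highest carrying one.
data Carry : List ℕ → ℕ → ℕ → ℕ → Set where
  low : ∀ {m ms a b} → let d = suc (m ∸ 1) in d ≤ a % d +ℕ b % d → NoCarry ms (a / d) (b / d) →
    Carry (m ∷ ms) a b (m ∸ 1 +ℕ (a / d +ℕ b / d) *ℕ d)
  up  : ∀ {m ms a b q} → let d = suc (m ∸ 1) in Carry ms (a / d) (b / d) q →
    Carry (m ∷ ms) a b (m ∸ 1 +ℕ q *ℕ d)

carry? : ∀ ns a b → NoCarry ns a b ⊎ ∃ (Carry ns a b)
carry? []       a b = inj₁ tt
carry? (m ∷ ms) a b with carry? ms (a / suc (m ∸ 1)) (b / suc (m ∸ 1))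
... | inj₂ (q , carry) = inj₂ (_ , up carry)
... | inj₁ noCarry with ℕ.<-≤-connex (a % suc (m ∸ 1) +ℕ b % suc (m ∸ 1)) (suc (m ∸ 1))
...   | inj₁ small = inj₁ (small , noCarry)
...   | inj₂ large = inj₂ (_ , low large noCarry)

-- Only an inequality: `index` drops whatever lies beyond the last digit, and `NoCarry` puts no
-- condition there.
noCarry⇒index≤ : ∀ ns {a b} → NoCarry ns a b → index ns a b ≤ a +ℕ b
noCarry⇒index≤ []       _ = z≤n
noCarry⇒index≤ (m ∷ ms) {a} {b} (small , noCarry) = ≡.subst (index (m ∷ ms) a b ≤_)
  (≡.sym (m+n≡%+/ d a b))
  (ℕ.+-mono-≤ (ℕ.≤-reflexive (m<n⇒m%n≡m small)) (ℕ.*-monoˡ-≤ d (noCarry⇒index≤ ms noCarry)))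
  where d = suc (m ∸ 1)

noCarry⇒index≡ : ∀ {ns} → All (1 <_) ns → ∀ {a b} → a < product ns → b < product ns →
  NoCarry ns a b → index ns a b ≡ a +ℕ b
noCarry⇒index≡ [] {zero} {zero} _ _ _ = ≡.refl
noCarry⇒index≡ [] {suc _} (s≤s ()) _ _
noCarry⇒index≡ [] {zero} {suc _} _ (s≤s ()) _
noCarry⇒index≡ {m ∷ ms} (s≤s (s≤s z≤n) ∷ 1<ms) {a} {b} a<n b<n (small , noCarry) = ≡.trans
  (≡.cong₂ (λ r q → r +ℕ q *ℕ m) (m<n⇒m%n≡m small)
    (noCarry⇒index≡ 1<ms (/-<product ms a<n) (/-<product ms b<n) noCarry))
  (≡.sym (m+n≡%+/ m a b))

carry⇒index≤ : ∀ {ns a b k} → Carry ns a b k → index ns a b ≤ k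
carry⇒index≤ {m ∷ ms} {a} {b} (low _ noCarry) = ℕ.+-mono-≤
  (s≤s⁻¹ (m%n<n (a % suc (m ∸ 1) +ℕ b % suc (m ∸ 1)) (suc (m ∸ 1))))
  (ℕ.*-monoˡ-≤ (suc (m ∸ 1)) (noCarry⇒index≤ ms noCarry))
carry⇒index≤ {m ∷ ms} {a} {b} (up carry) = ℕ.+-mono-≤
  (s≤s⁻¹ (m%n<n (a % suc (m ∸ 1) +ℕ b % suc (m ∸ 1)) (suc (m ∸ 1))))
  (ℕ.*-monoˡ-≤ (suc (m ∸ 1)) (carry⇒index≤ carry))

noCarry-∷ : ∀ {m} ms {x y q r} → let d = suc (m ∸ 1) in x +ℕ y < d → NoCarry ms q r →
  NoCarry (m ∷ ms) (x +ℕ q *ℕ d) (y +ℕ r *ℕ d)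
noCarry-∷ {m} ms {x} {y} {q} {r} x+y<d noCarry
  rewrite [i+lN]%N≡i (suc (m ∸ 1)) q (ℕ.m+n≤o⇒m≤o (suc x) x+y<d)
        | [i+lN]%N≡i (suc (m ∸ 1)) r (ℕ.≤-<-trans (ℕ.m≤n+m y x) x+y<d)
        | [i+lN]/N≡l (suc (m ∸ 1)) q (ℕ.m+n≤o⇒m≤o (suc x) x+y<d)
        | [i+lN]/N≡l (suc (m ∸ 1)) r (ℕ.≤-<-trans (ℕ.m≤n+m y x) x+y<d) = x+y<d , noCarry

-- Lowering one of the digits of the highest carrying position frees all the digits below it.
carry-reached : ∀ {ns a b k} → Carry ns a b k → ∃₂ λ a′ b′ → a′ ≤ a × b′ ≤ b ×
  (a′ < a ⊎ b′ < b) × NoCarry ns a′ b′ × a′ +ℕ b′ ≡ k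
carry-reached {m ∷ ms} {a} {b} (low large noCarry) =
  a , b′ , ℕ.≤-refl , ℕ.<⇒≤ b′<b , inj₂ b′<b ,
  ≡.subst (λ x → NoCarry (m ∷ ms) x b′) (≡.sym (m≡m%n+[m/n]*n a d))
    (noCarry-∷ {m} ms {a % d} {m ∸ 1 ∸ a % d} (s≤s (ℕ.≤-reflexive fill)) noCarry) ,
  ≡.trans (≡.cong (_+ℕ b′) (m≡m%n+[m/n]*n a d))
    (≡.trans (digitwise-+ d (a % d) (m ∸ 1 ∸ a % d) (a / d) (b / d)) (≡.cong (_+ℕ (a / d +ℕ b / d) *ℕ d) fill))
  where
  d = suc (m ∸ 1)
  -- The digit of b is lowered to complement that of a to m - 1. Since the two digits carried, this
  -- is a proper decrease.
  b′ = (m ∸ 1 ∸ a % d) +ℕ (b / d) *ℕ d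
  fill : a % d +ℕ (m ∸ 1 ∸ a % d) ≡ m ∸ 1
  fill = ℕ.m+[n∸m]≡n (s≤s⁻¹ (m%n<n a d))
  b′<b : b′ < b
  b′<b = ≡.subst (b′ <_) (≡.sym (m≡m%n+[m/n]*n b d)) (ℕ.+-monoˡ-< ((b / d) *ℕ d)
    (ℕ.+-cancelˡ-< (a % d) _ _ (≡.subst (_< a % d +ℕ b % d) (≡.sym fill) large)))
carry-reached {m ∷ ms} {a} {b} (up {q = q} carry)
  with a₁ , b₁ , a₁≤ , b₁≤ , strict , noCarry , sum ← carry-reached carry | strict
... | inj₁ a₁< =
  -- As a₁ is smaller than the upper part of a, the digit m - 1 may be put below it without
  -- exceeding a. The partner takes the digit 0, so the sum reaches the maximal digit without a
  -- carry.
  m ∸ 1 +ℕ a₁ *ℕ d , b₁ *ℕ d , ℕ.<⇒≤ a′<a ,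
  ℕ.≤-trans (ℕ.*-monoˡ-≤ d b₁≤) (m/n*n≤m b d) , inj₁ a′<a ,
  noCarry-∷ {m} ms {m ∸ 1} {0} (s≤s (ℕ.≤-reflexive (ℕ.+-identityʳ _))) noCarry ,
  ≡.trans (digitwise-+ d (m ∸ 1) 0 a₁ b₁) (≡.cong₂ (λ r q → r +ℕ q *ℕ d) (ℕ.+-identityʳ (m ∸ 1)) sum)
  where
  d = suc (m ∸ 1)
  a′<a : m ∸ 1 +ℕ a₁ *ℕ d < a
  a′<a = ℕ.<-≤-trans (i+lN<jN d ℕ.≤-refl a₁<) (m/n*n≤m a d)
... | inj₂ b₁< =
  a₁ *ℕ d , m ∸ 1 +ℕ b₁ *ℕ d , ℕ.≤-trans (ℕ.*-monoˡ-≤ d a₁≤) (m/n*n≤m a d) ,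
  ℕ.<⇒≤ b′<b , inj₂ b′<b ,
  noCarry-∷ {m} ms {0} {m ∸ 1} ℕ.≤-refl noCarry ,
  ≡.trans (digitwise-+ d 0 (m ∸ 1) a₁ b₁) (≡.cong (λ q → m ∸ 1 +ℕ q *ℕ d) sum)
  where
  d = suc (m ∸ 1)
  b′<b : m ∸ 1 +ℕ b₁ *ℕ d < b
  b′<b = ℕ.<-≤-trans (i+lN<jN d ℕ.≤-refl b₁<) (m/n*n≤m b d)

-- The group law of H never carries, so the upper digits of a product depend on the upper digits of
-- the factors alone.
index-/ : ∀ {pre} → All (1 <_) pre → ∀ post a b .{{_ : NonZero (product pre)}} →
  index (pre ++ post) a b / product pre ≡ index post (a / product pre) (b / product pre)
index-/ [] post a b = ≡.trans (n/1≡n _) (≡.sym (≡.cong₂ (index post) (n/1≡n a) (n/1≡n b)))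
index-/ {m ∷ pre} (s≤s (s≤s z≤n) ∷ 1<pre) post a b = begin
  index (m ∷ pre ++ post) a b / (m *ℕ N)    ≡⟨ m/n/o≡m/[n*o] _ m N ⟨
  index (m ∷ pre ++ post) a b / m / N
    ≡⟨ ≡.cong (_/ N) ([i+lN]/N≡l m _ (m%n<n (a % m +ℕ b % m) m)) ⟩
  index (pre ++ post) (a / m) (b / m) / N   ≡⟨ index-/ 1<pre post (a / m) (b / m) ⟩
  index post (a / m / N) (b / m / N)
    ≡⟨ ≡.cong₂ (index post) (m/n/o≡m/[n*o] a m N) (m/n/o≡m/[n*o] b m N) ⟩
  index post (a / (m *ℕ N)) (b / (m *ℕ N))  ∎
  where
  open ≡.≡-Reasoning
  N = product pre
  instance
    N≢0 : NonZero N
    N≢0 = product-nonZero 1<pre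

index-0 : ∀ ns → index ns 0 0 ≡ 0
index-0 []       = ≡.refl
index-0 (m ∷ ms) = ≡.cong (_*ℕ suc (m ∸ 1)) (index-0 ms)

index<-prefix : ∀ {pre} → All (1 <_) pre → ∀ post {a b} → a < product pre → b < product pre →
  index (pre ++ post) a b < product pre
index<-prefix {pre} 1<pre post {a} {b} a<N b<N = m/n≡0⇒m<n
  (≡.trans (index-/ 1<pre post a b) (≡.trans
    (≡.cong₂ (index post) (m<n⇒m/n≡0 a<N) (m<n⇒m/n≡0 b<N)) (index-0 post)))
  where
  instance
    N≢0 : NonZero (product pre)
    N≢0 = product-nonZero 1<pre

index-small : ∀ {m} → 1 < m → ∀ ms {x y} → x +ℕ y < m → index (m ∷ ms) x y ≡ x +ℕ y
index-small {m} (s≤s (s≤s z≤n)) ms {x} {y} x+y<m = ≡.trans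
  (≡.cong₂ (λ r q → r +ℕ q *ℕ m)
    (≡.trans (≡.cong (_% m) (≡.cong₂ _+ℕ_ (m<n⇒m%n≡m x<m) (m<n⇒m%n≡m y<m))) (m<n⇒m%n≡m x+y<m))
    (≡.trans (≡.cong₂ (index ms) (m<n⇒m/n≡0 x<m) (m<n⇒m/n≡0 y<m)) (index-0 ms)))
  (ℕ.+-identityʳ _)
  where
  x<m : x < m
  x<m = ℕ.m+n≤o⇒m≤o (suc x) x+y<m
  y<m : y < m
  y<m = ℕ.≤-<-trans (ℕ.m≤n+m y x) x+y<m

module _ {pre : List ℕ} {m : ℕ} {post : List ℕ} (1<pre : All (1 <_) pre) (1<m : 1 < m) where

  private
    N = product pre
    ns = pre ++ m ∷ post
    instance
      N≢0 : NonZero N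
      N≢0 = product-nonZero 1<pre

  index-block : ∀ a b → a / N +ℕ b / N < m → index ns a b / N ≡ a / N +ℕ b / N
  index-block a b small = ≡.trans (index-/ 1<pre (m ∷ post) a b) (index-small 1<m post {a / N} {b / N} small)

  -- A factor below N leaves the block number `a / N` unchanged: the combinatorial form of E G_(jN)
  -- ⊆ G_(jN).
  index<-scalars : ∀ {j a b} → j ≤ m → a < j *ℕ N → b < N → index ns a b < j *ℕ N
  index<-scalars {j} {a} {b} j≤m a<jN b<N = m/N<j⇒m<jN N
    (≡.subst (_< j) (≡.sym (≡.trans (index-block a b (ℕ.<-≤-trans sum<j j≤m)) sum≡)) a/N<j)
    where
    a/N<j : a / N < j
    a/N<j = m<n*o⇒m/o<n a<jN
    sum≡ : a / N +ℕ b / N ≡ a / N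
    sum≡ = ≡.trans (≡.cong (a / N +ℕ_) (m<n⇒m/n≡0 b<N)) (ℕ.+-identityʳ _)
    sum<j : a / N +ℕ b / N < j
    sum<j = ≡.subst (_< j) (≡.sym sum≡) a/N<j

  -- A factor of at most N raises the block number by at most one.
  index<-step : ∀ {j a b} → j < m → a < j *ℕ N → b ≤ N → index ns a b < suc j *ℕ N
  index<-step {j} {a} {b} j<m a<jN b≤N = m/N<j⇒m<jN N (s≤s
    (≡.subst (_≤ j) (≡.sym (index-block a b (ℕ.≤-<-trans sum≤j j<m))) sum≤j))
    where
    sum≤j : a / N +ℕ b / N ≤ j
    sum≤j = ℕ.≤-trans (ℕ.+-monoʳ-≤ (a / N) (ℕ.≤-trans (/-monoˡ-≤ N b≤N) (ℕ.≤-reflexive (n/n≡1 N))))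
      (≡.subst (_≤ j) (≡.sym (ℕ.+-comm (a / N) 1)) (m<n*o⇒m/o<n a<jN))

  -- The product of v_(jN) and v_N has block number j + 1. This is what forbids G_((j+1)N) to absorb
  -- multiplication by G_(N+1).
  index≥-step : ∀ {j} → suc j < m → suc j *ℕ N ≤ index ns (j *ℕ N) N
  index≥-step {j} 1+j<m = ≡.subst (λ q → q *ℕ N ≤ index ns (j *ℕ N) N)
    (≡.trans (index-block (j *ℕ N) N (≡.subst (_< m) (≡.sym sum≡) 1+j<m)) sum≡)
    (m/n*n≤m (index ns (j *ℕ N) N) N)
    where
    sum≡ : (j *ℕ N) / N +ℕ N / N ≡ suc j
    sum≡ = ≡.trans (≡.cong₂ _+ℕ_ (m*n/n≡m j N) (n/n≡1 N)) (ℕ.+-comm j 1)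

-- Field extensions

module Extensions {c ℓ} (L : Field c ℓ) where
  open Field L hiding (zero)
  open import Relation.Binary.Reasoning.Setoid setoid
  open CommutativeSemigroupProperties *-commutativeSemigroup using (x∙yz≈y∙xz)
  open import Algebra.Properties.Semiring.Exp semiring using (_^_)
  open Sums commutativeRing
  open Linear L

  -- Families indexed by `Fin` and by `ℕ`.

  extend : ∀ {n} → (Fin n → Carrier) → ℕ → Carrier
  extend {zero}  f i       = 0#
  extend {suc n} f zero    = f fzero
  extend {suc n} f (suc i) = extend (f ∘ fsuc) i

  extend-toℕ : ∀ {n} (f : Fin n → Carrier) i → extend f (toℕ i) ≡ f i
  extend-toℕ f fzero    = ≡.refl
  extend-toℕ f (fsuc i) = extend-toℕ (f ∘ fsuc) i

  extend-all : ∀ {p} (P : Pred Carrier p) → P 0# → ∀ {n} (f : Fin n → Carrier) →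
    (∀ i → P (f i)) → ∀ i → P (extend f i)
  extend-all P P0 {zero}  f Pf i       = P0
  extend-all P P0 {suc n} f Pf zero    = Pf fzero
  extend-all P P0 {suc n} f Pf (suc i) = extend-all P P0 (f ∘ fsuc) (Pf ∘ fsuc) i

  sumF≈∑ : ∀ n (f : Fin n → Carrier) (g : ℕ → Carrier) → (∀ i → f i ≈ g (toℕ i)) →
    sumF L f ≈ ∑ n g
  sumF≈∑ zero    f g eq = refl
  sumF≈∑ (suc n) f g eq = +-cong (eq fzero) (sumF≈∑ n (f ∘ fsuc) (g ∘ suc) (eq ∘ fsuc))

  Fin-elim : ∀ {a n} (P : ℕ → Set a) → (∀ (i : Fin n) → P (toℕ i)) → ∀ i → i < n → P i
  Fin-elim P h i i<n = ≡.subst P (Fin.toℕ-fromℕ< i<n) (h (fromℕ< i<n))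

  module _ {p q} {S : Pred Carrier p} {V : Pred Carrier q} (isS : IsSubfield L S) where
    private module S = IsSubfield isS

    hasDim⇒basis : ∀ {n} → HasDim L S V n → ∃ λ w → IsBasis S V n w
    hasDim⇒basis {n} (b , Vb , ind , spn) = extend b , record
      { mem   = Fin-elim (V ∘ extend b) (λ i → ≡.subst V (≡.sym (extend-toℕ b i)) (Vb i))
      ; indep = λ co Sco eq → Fin-elim (λ i → co i ≈ 0#) (ind (co ∘ toℕ) (Sco ∘ toℕ)
          (trans (sumF≈∑ n _ (λ i → co i * extend b i) (λ i →
            *-congˡ (reflexive (≡.sym (extend-toℕ b i))))) eq))
      ; span  = λ {x} Vx → let co , Sco , x≈ = spn x Vx in
          extend co , extend-all S S.has0 co Sco ,
          trans x≈ (sumF≈∑ n _ (λ i → extend co i * extend b i) (λ i →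
            *-cong (reflexive (≡.sym (extend-toℕ co i))) (reflexive (≡.sym (extend-toℕ b i)))))
      }

    basis⇒hasDim : ∀ {n w} → IsBasis S V n w → HasDim L S V n
    basis⇒hasDim {n} {w} isB =
      w ∘ toℕ , (λ i → mem (toℕ i) (Fin.toℕ<n i)) ,
      (λ co Sco eq i → trans (reflexive (≡.sym (extend-toℕ co i)))
        (indep (extend co) (extend-all S S.has0 co Sco)
          (trans (sym (sumF≈∑ n _ (λ i → extend co i * w i) (λ i →
            *-congʳ (reflexive (≡.sym (extend-toℕ co i)))))) eq) (toℕ i) (Fin.toℕ<n i))) ,
      λ x Vx → let co , Sco , x≈ = span Vx in
        co ∘ toℕ , Sco ∘ toℕ ,
        trans x≈ (sym (sumF≈∑ n _ (λ i → co i * w i) (λ _ → refl)))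
      where open IsBasis isB

  basis-scalars : ∀ {p p′ q} {S : Pred Carrier p} {S′ : Pred Carrier p′} {V : Pred Carrier q} {n w} →
    S ⊆ S′ → S′ ⊆ S → IsBasis S V n w → IsBasis S′ V n w
  basis-scalars S⊆S′ S′⊆S isB = record
    { mem   = mem
    ; indep = λ co S′co → indep co (S′⊆S ∘ S′co)
    ; span  = λ Vx → let co , Sco , x≈ = span Vx in co , S⊆S′ ∘ Sco , x≈
    }
    where open IsBasis isB

  basis-space : ∀ {p q q′} {S : Pred Carrier p} {V : Pred Carrier q} {V′ : Pred Carrier q′} {n w} →
    V ⊆ V′ → V′ ⊆ V → IsBasis S V n w → IsBasis S V′ n w
  basis-space V⊆V′ V′⊆V isB = record
    { mem = λ i i<n → V⊆V′ (mem i i<n) ; indep = indep ; span = span ∘ V′⊆V }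
    where open IsBasis isB

  -- The basis of the tower law, with the index of `e` as lowest digit. This numbering is the mixed
  -- radix one, and the products with the first j of the `w` form an initial segment.
  products : (ℕ → Carrier) → ∀ N → .{{NonZero N}} → (ℕ → Carrier) → ℕ → Carrier
  products e N w r = e (r % N) * w (r / N)

  module _ (N : ℕ) .{{_ : NonZero N}} where

    ∑-products : ∀ m (a e w : ℕ → Carrier) →
      ∑ (m *ℕ N) (λ r → a r * products e N w r) ≈
      ∑ m (λ l → ∑ N (λ i → a (i +ℕ l *ℕ N) * e i) * w l)
    ∑-products m a e w = begin
      ∑ (m *ℕ N) (λ r → a r * products e N w r)
        ≈⟨ ∑-blocks m N (λ r → a r * products e N w r) ⟩
      ∑ m (λ l → ∑ N (λ i → a (i +ℕ l *ℕ N) * products e N w (i +ℕ l *ℕ N)))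
        ≈⟨ ∑-cong m (λ l _ → ∑-cong N (λ i i<N → trans
             (*-congˡ (reflexive (≡.cong₂ (λ i l → e i * w l) ([i+lN]%N≡i N l i<N) ([i+lN]/N≡l N l i<N))))
             (sym (*-assoc (a (i +ℕ l *ℕ N)) (e i) (w l))))) ⟩
      ∑ m (λ l → ∑ N (λ i → a (i +ℕ l *ℕ N) * e i * w l))
        ≈⟨ ∑-cong m (λ l _ → ∑-* N (λ i → a (i +ℕ l *ℕ N) * e i) (w l)) ⟨
      ∑ m (λ l → ∑ N (λ i → a (i +ℕ l *ℕ N) * e i) * w l) ∎

    module _ {p q r} {K : Pred Carrier p} {E : Pred Carrier q} {V : Pred Carrier r}
      (isK : IsSubfield L K) (E/K : IsSubspace L K E) (V/E : IsSubspace L E V)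
      {e : ℕ → Carrier} (isE : IsBasis K E N e) where

      private
        module K = IsSubfield isK
        module E = Over.Subspace isK E/K
        module B = IsBasis isE

      products-mem : ∀ m {w} → (∀ l → l < m → V (w l)) → ∀ r → r < m *ℕ N → V (products e N w r)
      products-mem m Vw r r<mN =
        IsSubspace.smul V/E (B.mem (r % N) (m%n<n r N)) (Vw (r / N) (m<n*o⇒m/o<n r<mN))

      block-mem : ∀ (a : ℕ → Carrier) → (∀ i → K (a i)) → ∀ l → E (∑ N (λ i → a (i +ℕ l *ℕ N) * e i))
      block-mem a Ka l = E.combination-mem N B.mem (_ , (λ i → Ka (i +ℕ l *ℕ N)) , refl)

      block-zero : ∀ (a : ℕ → Carrier) → (∀ i → K (a i)) → ∀ r →
        ∑ N (λ i → a (i +ℕ (r / N) *ℕ N) * e i) ≈ 0# → a r ≈ 0#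
      block-zero a Ka r eq = trans (reflexive (≡.cong a (m≡m%n+[m/n]*n r N)))
        (B.indep (λ i → a (i +ℕ (r / N) *ℕ N)) (λ i → Ka _) eq (r % N) (m%n<n r N))

      refine : ∀ (d : ℕ → Carrier) → (∀ l → E (d l)) →
        ∃ λ (a : ℕ → Carrier) → (∀ i → K (a i)) × (∀ l → d l ≈ ∑ N (λ i → a (i +ℕ l *ℕ N) * e i))
      refine d Ed = (λ r → coeff (r / N) (r % N)) , (λ r → proj₁ (proj₂ (B.span (Ed _))) _) ,
        λ l → trans (proj₂ (proj₂ (B.span (Ed l)))) (∑-cong N (λ i i<N →
          *-congʳ (reflexive (≡.cong₂ coeff (≡.sym ([i+lN]/N≡l N l i<N)) (≡.sym ([i+lN]%N≡i N l i<N))))))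
        where
        coeff : ℕ → ℕ → Carrier
        coeff l = proj₁ (B.span (Ed l))

      refine-∑ : ∀ m {d a : ℕ → Carrier} (w : ℕ → Carrier) →
        (∀ l → d l ≈ ∑ N (λ i → a (i +ℕ l *ℕ N) * e i)) →
        ∑ m (λ l → d l * w l) ≈ ∑ (m *ℕ N) (λ r → a r * products e N w r)
      refine-∑ m {d} {a} w eq =
        trans (∑-cong m (λ l _ → *-congʳ (eq l))) (sym (∑-products m a e w))

      products-weaklyIndependent : ∀ m {w} → WeaklyIndependent E m w →
        WeaklyIndependent K (m *ℕ N) (products e N w)
      products-weaklyIndependent m {w} wi a Ka eq r r<mN ¬z =
        wi (λ l → ∑ N (λ i → a (i +ℕ l *ℕ N) * e i)) (block-mem a Ka)
          (trans (sym (∑-products m a e w)) eq) (r / N) (m<n*o⇒m/o<n r<mN)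
          (¬z ∘ block-zero a Ka r)

      products-basis : ∀ m {w} → IsBasis E V m w → IsBasis K V (m *ℕ N) (products e N w)
      products-basis m {w} isW = record
        { mem   = products-mem m W.mem
        ; indep = λ a Ka eq r r<mN → block-zero a Ka r
            (W.indep (λ l → ∑ N (λ i → a (i +ℕ l *ℕ N) * e i)) (block-mem a Ka)
              (trans (sym (∑-products m a e w)) eq) (r / N) (m<n*o⇒m/o<n r<mN))
        ; span  = λ Vx →
            let d , Ed , x≈ = W.span Vx
                a , Ka , eq = refine d Ed in
            a , Ka , trans x≈ (refine-∑ m w eq)
        }
        where module W = IsBasis isW

      products-combination : ∀ m {w x} → Combination E m w x →
        Combination K (m *ℕ N) (products e N w) x
      products-combination m {w} (d , Ed , x≈) =
        let a , Ka , eq = refine d Ed in a , Ka , trans x≈ (refine-∑ m w eq)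

      -- The products are weakly independent over K and as many as the K-dimension of `V`, hence a
      -- K-basis. Collecting its coefficients in blocks of length N gives coefficients in `E`.
      regroup-basis : ∀ m {b w} → IsBasis K V (m *ℕ N) b → (∀ l → l < m → V (w l)) →
        WeaklyIndependent E m w → IsBasis E V m w
      regroup-basis m {b} {w} isB Vw wi = record
        { mem   = Vw
        ; indep = λ d Ed eq l l<m →
            let a , Ka , d≈ = refine d Ed
                a≈0 = P.indep a Ka (trans (sym (refine-∑ m w d≈)) eq) in
            trans (d≈ l) (∑-zero N (λ i i<N → trans (*-congʳ (a≈0 (i +ℕ l *ℕ N)
              (ℕ.<-≤-trans (ℕ.+-monoˡ-< (l *ℕ N) i<N) (ℕ.*-monoˡ-≤ N l<m)))) (zeroˡ (e i))))
        ; span  = λ Vx → let a , Ka , x≈ = P.span Vx in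
            (λ l → ∑ N (λ i → a (i +ℕ l *ℕ N) * e i)) , block-mem a Ka ,
            trans x≈ (∑-products m a e w)
        }
        where
        module P = IsBasis (Over.weaklyIndependent⇒basis isK isB (products-mem m Vw)
          (products-weaklyIndependent m wi))

  -- Closure under inverses, and powers of a generator.

  inverse-cancel : ∀ {x y} → x * y ≈ 1# → ∀ z → y * (x * z) ≈ z
  inverse-cancel {x} {y} xy≈1 z = begin
    y * (x * z) ≈⟨ *-assoc y x z ⟨
    y * x * z   ≈⟨ *-congʳ (trans (*-comm y x) xy≈1) ⟩
    1# * z      ≈⟨ *-identityˡ z ⟩
    z           ∎

  -- Multiplication by x maps a basis of V to a weakly independent family, hence to a basis.
  inverse-closed : ∀ {p q} {K : Pred Carrier p} {V : Pred Carrier q} → IsSubfield L K →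
    IsSubspace L K V → (∀ {x y} → V x → V y → V (x * y)) → V 1# → ∀ {N b} → IsBasis K V N b →
    ∀ {x y} → V x → x * y ≈ 1# → V y
  inverse-closed {K = K} {V} isK isV *-cl V1 {N} {b} isB {x} {y} Vx xy≈1 =
    resp (sym y≈z) (combination-mem N B.mem (co , Kco , refl))
    where
    module B = IsBasis isB
    open Over isK
    open Subspace isV
    factor : ∀ (a : ℕ → Carrier) → ∑ N (λ i → a i * (x * b i)) ≈ x * ∑ N (λ i → a i * b i)
    factor a = trans (∑-cong N (λ i _ → x∙yz≈y∙xz (a i) x (b i))) (sym (*-∑ N x (λ i → a i * b i)))
    cancel : ∀ z → y * (x * z) ≈ z
    cancel = inverse-cancel xy≈1
    indep : Independent K N (λ i → x * b i)
    indep a Ka eq = B.indep a Ka (begin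
      ∑ N (λ i → a i * b i)           ≈⟨ cancel _ ⟨
      y * (x * ∑ N (λ i → a i * b i)) ≈⟨ *-congˡ (trans (sym (factor a)) eq) ⟩
      y * 0#                          ≈⟨ zeroʳ y ⟩
      0#                              ∎)
    one : Combination K N (λ i → x * b i) 1#
    one = IsBasis.span (weaklyIndependent⇒basis isB (λ i i<N → *-cl Vx (B.mem i i<N))
      (weaken {w = λ i → x * b i} indep)) V1
    co : ℕ → Carrier
    co = proj₁ one
    Kco : ∀ i → K (co i)
    Kco = proj₁ (proj₂ one)
    y≈z : y ≈ ∑ N (λ i → co i * b i)
    y≈z = begin
      y                                ≈⟨ *-identityʳ y ⟨
      y * 1#                           ≈⟨ *-congˡ (trans (proj₂ (proj₂ one)) (factor co)) ⟩
      y * (x * ∑ N (λ i → co i * b i)) ≈⟨ cancel _ ⟩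
      ∑ N (λ i → co i * b i)           ∎

  power-mem : ∀ {q} {V : Pred Carrier q} → V 1# → ∀ {x} → (∀ y → V y → V (x * y)) → ∀ k → V (x ^ k)
  power-mem V1 xV zero    = V1
  power-mem V1 xV (suc k) = xV _ (power-mem V1 xV k)

  generator-*-mem : ∀ {p q} {E : Pred Carrier p} {V : Pred Carrier q} → IsSubfield L E →
    IsSubspace L E V → ∀ {d α} → (∀ i → i < d → V (α ^ suc i)) →
    ∀ {x} → Combination E d (α ^_) x → V (α * x)
  generator-*-mem isE isV {d} {α} next {x} (co , Eco , x≈) = resp
    (trans (∑-cong d (λ i _ → x∙yz≈y∙xz (co i) α (α ^ i)))
      (trans (sym (*-∑ d α _)) (*-congˡ (sym x≈))))
    (∑-mem d (λ i i<d → smul (Eco i) (next i i<d)))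
    where open Over.Subspace isE isV

  -- W is only spanned, not known to have a basis, whence the double negation: if y were
  -- outside W, then all the powers of x would be independent.
  inverse-closed-¬¬ : ∀ {p q} {E : Pred Carrier p} {W : Pred Carrier q} → IsSubfield L E →
    IsSubspace L E W → (∀ {x y} → W x → W y → W (x * y)) → W 1# →
    ∀ {d g} → (∀ x → W x → Combination E d g x) → ∀ {x y} → W x → x * y ≈ 1# → ¬ ¬ W y
  inverse-closed-¬¬ {E = E} {W} isE isW *-cl W1 {d} {g} spanned {x} {y} Wx xy≈1 ¬Wy =
    overspanned-dependent (λ i _ → spanned _ (Wpow i)) (powers-indep (suc d))
    where
    open Over isE
    open Subspace isW
    module E = IsSubfield isE
    Wpow : ∀ i → W (x ^ i)
    Wpow = power-mem W1 (λ z → *-cl {x} {z} Wx)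
    cancel : ∀ z → y * (x * z) ≈ z
    cancel = inverse-cancel xy≈1
    powers-indep : ∀ k → WeaklyIndependent E k (x ^_)
    powers-indep (suc k) co Eco eq = λ where
        zero    _         → head
        (suc i) (s≤s i<k) → λ ¬z → head λ co0≈0 →
          powers-indep k (co ∘ suc) (Eco ∘ suc) (tail co0≈0) i i<k ¬z
      where
      z : Carrier
      z = ∑ k (λ i → co (suc i) * x ^ i)
      eq′ : co 0 * 1# + x * z ≈ 0#
      eq′ = trans (+-congˡ (trans (*-∑ k x _) (∑-cong k (λ i _ → x∙yz≈y∙xz x (co (suc i)) (x ^ i))))) eq
      -- The relation ∑ coᵢxⁱ = 0 multiplied by y. A nonzero `co 0` would express y through powers
      -- of x; a zero one leaves a relation with one power fewer.
      eq″ : co 0 * y + z ≈ 0#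
      eq″ = begin
        co 0 * y + z                     ≈⟨ +-cong (trans (*-congˡ (sym (*-identityʳ y))) (x∙yz≈y∙xz (co 0) y 1#)) (sym (cancel z)) ⟩
        y * (co 0 * 1#) + y * (x * z)    ≈⟨ distribˡ y _ _ ⟨
        y * (co 0 * 1# + x * z)          ≈⟨ *-congˡ eq′ ⟩
        y * 0#                           ≈⟨ zeroʳ y ⟩
        0#                               ∎
      head : ¬ ¬ co 0 ≈ 0#
      head co0≉0 = ¬Wy (solve (Eco 0) co0≉0 eq″ (∑-mem k (λ i _ → smul (Eco (suc i)) (Wpow i))))
      tail : co 0 ≈ 0# → z ≈ 0#
      tail co0≈0 = trans (sym (trans (+-congʳ (trans (*-congʳ co0≈0) (zeroˡ y))) (+-identityˡ z))) eq″

  module _ {p q} {E : Pred Carrier p} {E′ : Pred Carrier q} (isE : IsSubfield L E)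
    {m : ℕ} {β : ℕ → Carrier} (E′/E : IsBasis E E′ m β) {α : Carrier} (E′⊆E[α] : E′ ⊆ Adjoin L E α) where

    private
      module E = IsSubfield isE
      module B = IsBasis E′/E
      open Over isE

    -- A relation expressing α ^ d by lower powers makes their span a field, so that it
    -- contains E[α] = E′, whose dimension is larger.
    power-not-lower : ∀ d → d < m → ¬ Combination E d (α ^_) (α ^ d)
    power-not-lower d d<m relation =
      ¬¬-∀< {P = W ∘ β} (suc d) (λ i i≤d → adjoin⊆W (E′⊆E[α] (B.mem i (ℕ.≤-<-trans (s≤s⁻¹ i≤d) d<m))))
        λ Wβ → overspanned-dependent Wβ (weaken {w = β} (independent-≤ d<m B.indep))
      where
      W : Pred Carrier _
      W = Combination E d (α ^_)
      open Subspace (combination-subspace d (α ^_))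
      lower : ∀ i → i < d → W (α ^ suc i)
      lower i i<d with ℕ.m≤n⇒m<n∨m≡n i<d
      ... | inj₁ 1+i<d  = generator d (α ^_) (suc i) 1+i<d
      ... | inj₂ ≡.refl = relation
      α*W : ∀ {x} → W x → W (α * x)
      α*W = generator-*-mem isE (combination-subspace d (α ^_)) lower
      -- For d = 0 the relation itself says that α^0 lies in `W`. The copy `d′` is matched because
      -- `d` is fixed by the enclosing definition.
      W1 : ∀ d′ → d′ ≡ d → W (α ^ 0)
      W1 zero    ≡.refl = relation
      W1 (suc _) ≡.refl = generator d (α ^_) 0 z<s
      Wpow : ∀ i → W (α ^ i)
      Wpow = power-mem {V = W} (W1 d ≡.refl) (λ _ → α*W)
      α^i*W : ∀ i {y} → W y → W (α ^ i * y)
      α^i*W zero    Wy = resp (sym (*-identityˡ _)) Wy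
      α^i*W (suc i) Wy = resp (sym (*-assoc α (α ^ i) _)) (α*W (α^i*W i Wy))
      *-closed : ∀ {x y} → W x → W y → W (x * y)
      *-closed {x} {y} (co , Eco , x≈) Wy = resp
        (trans (∑-cong d (λ i _ → sym (*-assoc (co i) (α ^ i) y))) (trans (sym (∑-* d _ y)) (*-congʳ (sym x≈))))
        (∑-mem d (λ i _ → smul (Eco i) (α^i*W i Wy)))
      -- Only `ad-inv` forces the double negation: `inverse-closed-¬¬` gives no more for the span
      -- `W`.
      adjoin⊆W : ∀ {x} → Adjoin L E α x → ¬ ¬ W x
      adjoin⊆W (ad-base Ex)     k = k (resp (*-identityʳ _) (smul Ex (Wpow 0)))
      adjoin⊆W ad-gen           k = k (resp (*-identityʳ α) (Wpow 1))
      adjoin⊆W (ad-+ u v)       k = adjoin⊆W u λ Wx → adjoin⊆W v λ Wy → k (+-cl Wx Wy)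
      adjoin⊆W (ad-neg u)       k = adjoin⊆W u λ Wx → k (neg Wx)
      adjoin⊆W (ad-* u v)       k = adjoin⊆W u λ Wx → adjoin⊆W v λ Wy → k (*-closed Wx Wy)
      adjoin⊆W (ad-inv u xy≈1)  k = adjoin⊆W u λ Wx →
        inverse-closed-¬¬ {W = W} isE (combination-subspace d (α ^_)) *-closed (Wpow 0)
          {d} {α ^_} (λ _ → id) Wx xy≈1 k
      adjoin⊆W (ad-resp x≈y u)  k = adjoin⊆W u λ Wx → k (resp x≈y Wx)

    powers-weaklyIndependent : ∀ k → k ≤ m → WeaklyIndependent E k (α ^_)
    powers-weaklyIndependent zero    _   co Eco eq i ()
    powers-weaklyIndependent (suc k) k<m = snoc-weaklyIndependent (combination-subspace k (α ^_))
      (powers-weaklyIndependent k (ℕ.<⇒≤ k<m)) (generator k (α ^_)) (power-not-lower k k<m)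

    powers-basis : (∀ i → E′ (α ^ i)) → IsBasis E E′ m (α ^_)
    powers-basis E′pow = weaklyIndependent⇒basis E′/E (λ i _ → E′pow i)
      (powers-weaklyIndependent m ℕ.≤-refl)

-- From a flag to a tower

span⊆ : ∀ {c ℓ p q r} (L : Field c ℓ) {K : Pred (Field.Carrier L) p} {V : Pred (Field.Carrier L) q}
  {A : Pred (Field.Carrier L) r} → IsSubspace L K V → A ⊆ V → Span L K A ⊆ V
span⊆ L isV A⊆V sp-zero           = IsSubspace.has0 isV
span⊆ L isV A⊆V (sp-step Kk Aa s) =
  IsSubspace.+-cl isV (IsSubspace.smul isV Kk (A⊆V Aa)) (span⊆ L isV A⊆V s)
span⊆ L isV A⊆V (sp-resp x≈y s)   = IsSubspace.resp isV x≈y (span⊆ L isV A⊆V s)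

list-split : ∀ (ns : List ℕ) (s : Fin (length ns)) → ∃ λ post →
  take (toℕ s) ns ++ lookup ns s ∷ post ≡ ns ×
  product (take (suc (toℕ s)) ns) ≡ lookup ns s *ℕ product (take (toℕ s) ns)
list-split (m ∷ ms) fzero    = ms , ≡.refl , ≡.refl
list-split (m ∷ ms) (fsuc s) with post , eq , prod ← list-split ms s =
  post , ≡.cong (m ∷_) eq , ≡.trans (≡.cong (m *ℕ_) prod)
    (ℕ-x∙yz≈y∙xz m (lookup ms s) (product (take (toℕ s) ms)))
  where open CommutativeSemigroupProperties ℕ.*-commutativeSemigroup
          using () renaming (x∙yz≈y∙xz to ℕ-x∙yz≈y∙xz)

module FlagToTower {c ℓ} (L : Field c ℓ) {K : Pred (Field.Carrier L) (c ⊔ ℓ)}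
  (isK : IsSubfield L K) {ns : List ℕ} (1<ns : All (1 <_) ns)
  {F : Fin (product ns) → Pred (Field.Carrier L) (c ⊔ ℓ)} (isF : IsFlag L K (product ns) F)
  (type : ∀ i j k → FlagTypeIs L K F i j k ⇔ TowerTypeIs ns (toℕ i) (toℕ j) (toℕ k)) where

  open Field L hiding (zero)
  open import Relation.Binary.Reasoning.Setoid setoid
  open import Algebra.Properties.Semiring.Exp semiring using (_^_)
  open Sums commutativeRing
  open Linear L
  open Extensions L
  open Over isK using (module Subspace)
  private
    n = product ns
    module F = IsFlag isF
    module K = IsSubfield isK

  -- Inclusions between members of a flag are not decidable. The minimum is found in H, and `type`
  -- identifies it as the value of the flag type.
  flagType : ∀ i j → ∃ λ k → FlagTypeIs L K F i j k ×
    IndexBound ns (toℕ i) (toℕ j) (toℕ k) ×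
    (∀ k′ → k′ < toℕ k → ¬ IndexBound ns (toℕ i) (toℕ j) k′)
  flagType i j with k , k<n , bound , min , tower ← towerType 1<ns (toℕ i) (toℕ j) =
    fromℕ< k<n , Equivalence.from (type i j (fromℕ< k<n)) (transport (λ k → TowerTypeIs ns (toℕ i) (toℕ j) k) tower) ,
    transport (IndexBound ns (toℕ i) (toℕ j)) bound ,
    transport (λ k → ∀ k′ → k′ < k → ¬ IndexBound ns (toℕ i) (toℕ j) k′) min
    where
    transport : (P : ℕ → Set) → P k → P (toℕ (fromℕ< k<n))
    transport P = ≡.subst P (≡.sym (Fin.toℕ-fromℕ< k<n))

  flag-* : ∀ {i j k x y} → IndexBound ns (toℕ i) (toℕ j) (toℕ k) → F i x → F j y → F k (x * y)
  flag-* {i} {j} {k} {x} {y} bound Fx Fy with k₀ , (sub , _) , _ , min ← flagType i j =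
    F.mono k₀ k (ℕ.≮⇒≥ λ k<k₀ → min (toℕ k) k<k₀ bound)
      (sub (sp-resp (trans (+-identityʳ _) (*-identityˡ _))
        (sp-step K.has1 (x , y , Fx , Fy , refl) sp-zero)))

  -- If the bound failed, `k` would lie below the value of the flag type, against its minimality.
  -- Decidability of the bound turns this contradiction into a proof.
  flag-*⇒indexBound : ∀ {i j k} → (∀ {x y} → F i x → F j y → F k (x * y)) →
    IndexBound ns (toℕ i) (toℕ j) (toℕ k)
  flag-*⇒indexBound {i} {j} {k} closed = decidable-stable (indexBound? ns (toℕ i) (toℕ j) (toℕ k))
    λ ¬bound → let k₀ , (_ , minF) , bound , _ = flagType i j in
      minF k (ℕ.≰⇒> λ k₀≤k → ¬bound λ a b a≤i b≤j → ℕ.≤-trans (bound a b a≤i b≤j) k₀≤k)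
        (span⊆ L (F.subspace k) λ (x , y , Fx , Fy , z≈xy) →
          IsSubspace.resp (F.subspace k) (sym z≈xy) (closed Fx Fy))

  -- G k is the member of dimension k of the flag, namely F (k - 1).
  G : ℕ → Pred Carrier (c ⊔ ℓ)
  G k x = ∃ λ (i : Fin n) → toℕ i < k × F i x

  F⇒G : ∀ {k x} (k<n : k < n) → F (fromℕ< k<n) x → G (suc k) x
  F⇒G k<n Fx = fromℕ< k<n , s≤s (ℕ.≤-reflexive (Fin.toℕ-fromℕ< k<n)) , Fx

  G⇒F : ∀ {k x} (k<n : k < n) → G (suc k) x → F (fromℕ< k<n) x
  G⇒F k<n (i , i≤k , Fx) = F.mono i (fromℕ< k<n)
    (≡.subst (toℕ i ≤_) (≡.sym (Fin.toℕ-fromℕ< k<n)) (s≤s⁻¹ i≤k)) Fx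

  G-mono : ∀ {k k′} → k ≤ k′ → G k ⊆ G k′
  G-mono k≤k′ (i , i<k , Fx) = i , ℕ.<-≤-trans i<k k≤k′ , Fx

  G-subspace : ∀ {k} → 0 < k → k ≤ n → IsSubspace L K (G k)
  G-subspace {suc k} _ k<n = record
    { resp = λ x≈y → F⇒G k<n ∘ V.resp x≈y ∘ G⇒F k<n
    ; has0 = F⇒G k<n V.has0
    ; +-cl = λ Gx Gy → F⇒G k<n (V.+-cl (G⇒F k<n Gx) (G⇒F k<n Gy))
    ; smul = λ Kk Gx → F⇒G k<n (V.smul Kk (G⇒F k<n Gx))
    }
    where module V = IsSubspace (F.subspace (fromℕ< k<n))

  abstract
    G-basis : ∀ {k} → 0 < k → k ≤ n → ∃ λ b → IsBasis K (G k) k b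
    G-basis {suc k} _ k<n with b , isB ← hasDim⇒basis isK (F.dim (fromℕ< k<n)) =
      b , basis-space (F⇒G k<n) (G⇒F k<n)
        (≡.subst (λ d → IsBasis K (F (fromℕ< k<n)) (suc d) b) (Fin.toℕ-fromℕ< k<n) isB)

  G-* : ∀ {i j k} → 0 < k → k ≤ n → (∀ a b → a < i → b < j → index ns a b < k) →
    ∀ {x y} → G i x → G j y → G k (x * y)
  G-* {i} {j} {suc k} _ k<n bound (i′ , i′<i , Fx) (j′ , j′<j , Fy) = F⇒G k<n
    (flag-* {i′} {j′} (λ a b a≤i′ b≤j′ → ≡.subst (index ns a b ≤_) (≡.sym (Fin.toℕ-fromℕ< k<n))
      (s≤s⁻¹ (bound a b (ℕ.≤-<-trans a≤i′ i′<i) (ℕ.≤-<-trans b≤j′ j′<j)))) Fx Fy)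

  G-*⇒index< : ∀ {i j k} → i ≤ n → j ≤ n → 0 < k → k ≤ n →
    (∀ {x y} → G i x → G j y → G k (x * y)) → ∀ {a b} → a < i → b < j → index ns a b < k
  G-*⇒index< {suc i} {suc j} {suc k} i<n j<n _ k<n closed {a} {b} (s≤s a≤i) (s≤s b≤j) = s≤s
    (≡.subst (index ns a b ≤_) (Fin.toℕ-fromℕ< k<n)
      (flag-*⇒indexBound {fromℕ< i<n} {fromℕ< j<n} {fromℕ< k<n}
        (λ Fx Fy → G⇒F k<n (closed (F⇒G i<n Fx) (F⇒G j<n Fy)))
        a b (≡.subst (a ≤_) (≡.sym (Fin.toℕ-fromℕ< i<n)) a≤i)
        (≡.subst (b ≤_) (≡.sym (Fin.toℕ-fromℕ< j<n)) b≤j)))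

  0<n : 0 < n
  0<n = ℕ.≤-<-trans z≤n (index<product 1<ns 0 0)

  G-total : ∀ x → G n x
  G-total x = subst-G (ℕ.m+[n∸m]≡n 0<n) x
    where
    subst-G : ∀ {k} → suc k ≡ n → ∀ x → G n x
    subst-G {k} eq x = fromℕ< k<n , Fin.toℕ<n (fromℕ< k<n) ,
      F.last (fromℕ< k<n) (≡.trans (≡.cong suc (Fin.toℕ-fromℕ< k<n)) eq) x
      where
      k<n : k < n
      k<n = ℕ.≤-reflexive eq

  K⊆G : ∀ {k} → 0 < k → K ⊆ G k
  K⊆G {k} 0<k Kx = fromℕ< 0<n , ≡.subst (_< k) (≡.sym (Fin.toℕ-fromℕ< 0<n)) 0<k ,
    F.K⊆first (fromℕ< 0<n) (Fin.toℕ-fromℕ< 0<n) Kx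

  G1⊆K : G 1 ⊆ K
  G1⊆K (i , i<1 , Fx) = F.first⊆K i (ℕ.n<1⇒n≡0 i<1) Fx

  module _ {pre post : List ℕ} (split : pre ++ post ≡ ns) where

    private
      N = product pre
      1<pre : All (1 <_) pre
      1<pre = All.++⁻ˡ pre (≡.subst (All (1 <_)) (≡.sym split) 1<ns)
      1<post : All (1 <_) post
      1<post = All.++⁻ʳ pre (≡.subst (All (1 <_)) (≡.sym split) 1<ns)
      0<N : 0 < N
      0<N = ℕ.≤-<-trans z≤n (index<product 1<pre 0 0)

    prefix≤n : N ≤ n
    prefix≤n = ≡.subst (N ≤_) (≡.trans (≡.sym (product-++ pre post)) (≡.cong product split))
      (ℕ.m≤m*n N (product post) {{product-nonZero 1<post}})

    -- The first N elements of H form the subgroup of the factors in `pre`, and the flag type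
    -- carries closure under products over to `G N`. Inverses then come from finite dimension over
    -- K.
    G-subfield : IsSubfield L (G N)
    G-subfield = record
      { resp   = resp
      ; has0   = has0
      ; has1   = has1
      ; +-cl   = +-cl
      ; neg-cl = neg
      ; *-cl   = *-cl
      ; inv-cl = inverse-closed isK (G-subspace 0<N prefix≤n) *-cl has1 (proj₂ (G-basis 0<N prefix≤n))
      }
      where
      open Subspace (G-subspace 0<N prefix≤n)
      has1 : G N 1#
      has1 = K⊆G 0<N K.has1
      *-cl : ∀ {x y} → G N x → G N y → G N (x * y)
      *-cl = G-* 0<N prefix≤n λ a b a<N b<N → ≡.subst (λ ns → index ns a b < N) split
        (index<-prefix 1<pre post a<N b<N)

  module Step {pre : List ℕ} {m : ℕ} {post : List ℕ} (split : pre ++ m ∷ post ≡ ns) where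

    private
      N = product pre
      E = G N
      1<pre : All (1 <_) pre
      1<pre = All.++⁻ˡ pre (≡.subst (All (1 <_)) (≡.sym split) 1<ns)
      1<m : 1 < m
      1<m with p ∷ _ ← All.++⁻ʳ pre (≡.subst (All (1 <_)) (≡.sym split) 1<ns) = p
      instance
        N≢0 : NonZero N
        N≢0 = product-nonZero 1<pre
      0<N : 0 < N
      0<N = ℕ.≤-<-trans z≤n (index<product 1<pre 0 0)
      0<jN : ∀ {j} → 0 < j → 0 < j *ℕ N
      0<jN {suc j} _ = ℕ.<-≤-trans 0<N (ℕ.m≤m+n N (j *ℕ N))
      mN≤n : m *ℕ N ≤ n
      mN≤n = ≡.subst (_≤ n)
        (≡.trans (product-++ pre (m ∷ []))
          (≡.trans (≡.cong (N *ℕ_) (ℕ.*-identityʳ m)) (ℕ.*-comm N m)))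
        (prefix≤n {pre ++ m ∷ []} {post} (≡.trans (List.++-assoc pre (m ∷ []) post) split))
      jN≤n : ∀ {j} → j ≤ m → j *ℕ N ≤ n
      jN≤n j≤m = ℕ.≤-trans (ℕ.*-monoˡ-≤ N j≤m) mN≤n
      1+N≤n : suc N ≤ n
      1+N≤n = ℕ.<-≤-trans (ℕ.m<m+n N (0<jN {1} z<s)) (jN≤n 1<m)
      N≤n : N ≤ n
      N≤n = ℕ.<⇒≤ 1+N≤n

    isE : IsSubfield L E
    isE = G-subfield {pre} split

    private
      module E = IsSubfield isE
      E/K : IsSubspace L K E
      E/K = G-subspace 0<N N≤n
      e : ℕ → Carrier
      e = proj₁ (G-basis 0<N N≤n)
      E-basis : IsBasis K E N e
      E-basis = proj₂ (G-basis 0<N N≤n)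
      abstract
        primitive-element : ∃ λ α → G (suc N) α × IsBasis K (G (suc N)) (suc N) (α ◃ e)
        primitive-element = Over.complete-basis isK (proj₂ (G-basis 0<n ℕ.≤-refl)) G-total 1+N≤n
          (G-subspace z<s 1+N≤n) (proj₂ (G-basis z<s 1+N≤n)) E/K E-basis (G-mono (ℕ.n≤1+n N))

    α : Carrier
    α = proj₁ primitive-element

    private
      Gα : G (suc N) α
      Gα = proj₁ (proj₂ primitive-element)

      V/E : ∀ {j} → 0 < j → j ≤ m → IsSubspace L E (G (j *ℕ N))
      V/E {j} 0<j j≤m = record
        { resp = resp ; has0 = has0 ; +-cl = +-cl
        ; smul = λ Ek Vx → resp (*-comm _ _) (G-* (0<jN 0<j) (jN≤n j≤m)
            (λ a b a<jN b<N → ≡.subst (λ ns → index ns a b < j *ℕ N) split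
              (index<-scalars 1<pre 1<m j≤m a<jN b<N)) Vx Ek)
        }
        where open IsSubspace (G-subspace (0<jN 0<j) (jN≤n j≤m))

      V*α : ∀ {j} → 0 < j → j < m → ∀ {x y} → G (j *ℕ N) x → G (suc N) y → G (suc j *ℕ N) (x * y)
      V*α {j} 0<j j<m = G-* (0<jN {suc j} z<s) (jN≤n j<m) λ a b a<jN b≤N →
        ≡.subst (λ ns → index ns a b < suc j *ℕ N) split
          (index<-step 1<pre 1<m j<m a<jN (s≤s⁻¹ b≤N))

    -- If α ^ j lay in G (j N), then G (j N) would absorb G (N + 1) = E + K α, against the
    -- flag type.
    power-outside : ∀ {j} → 0 < j → j < m → IsBasis E (G (j *ℕ N)) j (α ^_) → ¬ G (j *ℕ N) (α ^ j)
    power-outside {suc j} _ j<m powers Vα^j = ℕ.<⇒≱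
      (G-*⇒index< (jN≤n (ℕ.<⇒≤ j<m)) 1+N≤n (0<jN {suc j} z<s) (jN≤n (ℕ.<⇒≤ j<m)) absorb
        {j *ℕ N} {N} (ℕ.m<n+m (j *ℕ N) 0<N) ℕ.≤-refl)
      (≡.subst (λ ns → suc j *ℕ N ≤ index ns (j *ℕ N) N) split (index≥-step 1<pre 1<m j<m))
      where
      module P = IsBasis powers
      module A = IsBasis (proj₂ (proj₂ primitive-element))
      open Over.Subspace isE (V/E {suc j} z<s (ℕ.<⇒≤ j<m))
      next : ∀ l → l < suc j → G (suc j *ℕ N) (α ^ suc l)
      next l l≤j with ℕ.m≤n⇒m<n∨m≡n l≤j
      ... | inj₁ l<j    = P.mem (suc l) l<j
      ... | inj₂ ≡.refl = Vα^j
      V*α⊆V : ∀ {x} → G (suc j *ℕ N) x → G (suc j *ℕ N) (α * x)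
      V*α⊆V Vx = generator-*-mem isE (V/E {suc j} z<s (ℕ.<⇒≤ j<m)) next (P.span Vx)
      absorb : ∀ {x y} → G (suc j *ℕ N) x → G (suc N) y → G (suc j *ℕ N) (x * y)
      -- In the basis `α ◃ e`, y is a K-multiple of α plus an element of E, and both parts map the
      -- space into itself.
      absorb {x} {y} Vx Gy = let co , Kco , y≈ = A.span Gy in resp
        (begin
          co 0 * (α * x) + ∑ N (λ i → co (suc i) * e i) * x
            ≈⟨ +-congʳ (*-assoc _ _ _) ⟨
          co 0 * α * x + ∑ N (λ i → co (suc i) * e i) * x ≈⟨ distribʳ x _ _ ⟨
          (co 0 * α + ∑ N (λ i → co (suc i) * e i)) * x   ≈⟨ *-congʳ y≈ ⟨
          y * x                                           ≈⟨ *-comm y x ⟩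
          x * y                                           ∎)
        (+-cl (smul (K⊆G 0<N (Kco 0)) (V*α⊆V Vx))
          (smul (Subspace.combination-mem E/K N (IsBasis.mem E-basis)
            ((co ∘ suc) , (Kco ∘ suc) , refl)) Vx))

    -- The new power lies outside G (j N) and inside G ((j + 1) N), so independence persists. The
    -- K-dimension of the larger space is known from the flag, so `regroup-basis` supplies the span.
    powers-basis-step : ∀ {j} → 0 < j → j < m →
      IsBasis E (G (j *ℕ N)) j (α ^_) → IsBasis E (G (suc j *ℕ N)) (suc j) (α ^_)
    powers-basis-step {suc j} _ j<m previous = regroup-basis N isK E/K (V/E z<s j<m) E-basis
      (suc (suc j)) (proj₂ (G-basis (0<jN {suc (suc j)} z<s) (jN≤n j<m))) mem
      (Over.snoc-weaklyIndependent isE (V/E {suc j} z<s (ℕ.<⇒≤ j<m))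
        (Over.weaken isE {w = α ^_} P.indep) P.mem (power-outside z<s j<m previous))
      where
      module P = IsBasis previous
      mem : ∀ l → l < suc (suc j) → G (suc (suc j) *ℕ N) (α ^ l)
      mem l l≤1+j with ℕ.m≤n⇒m<n∨m≡n l≤1+j
      ... | inj₁ l<1+j  = G-mono (ℕ.m≤n+m (suc j *ℕ N) N) (P.mem l (s≤s⁻¹ l<1+j))
      ... | inj₂ ≡.refl = IsSubspace.resp (G-subspace (0<jN {suc (suc j)} z<s) (jN≤n j<m))
        (*-comm _ _) (V*α z<s j<m (P.mem j ℕ.≤-refl) Gα)

    powers-basis-G : ∀ {j} → 0 < j → j ≤ m → IsBasis E (G (j *ℕ N)) j (α ^_)
    powers-basis-G {suc zero} _ _ = record
      { mem   = λ { zero _ → G-mono N≤1N E.has1 ; (suc _) (s≤s ()) }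
      ; indep = λ { co _ eq zero _ → trans (sym (trans (+-identityʳ _) (*-identityʳ (co 0)))) eq
                  ; _ _ _ (suc _) (s≤s ()) }
      ; span  = λ {x} Gx → (λ _ → x) , (λ _ → G-mono (ℕ.≤-reflexive (ℕ.*-identityˡ N)) Gx) ,
          sym (trans (+-identityʳ _) (*-identityʳ x))
      }
      where
      N≤1N : N ≤ 1 *ℕ N
      N≤1N = ℕ.≤-reflexive (≡.sym (ℕ.*-identityˡ N))
    powers-basis-G {suc (suc j)} _ 1+j<m =
      powers-basis-step z<s 1+j<m (powers-basis-G z<s (ℕ.<⇒≤ 1+j<m))

    -- `M` is kept apart from `m *ℕ N` because the product over the longer prefix of `ns` equals it
    -- only propositionally.
    step : ∀ {M} → M ≡ m *ℕ N → IsSubfield L (G M) →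
      E ⊆ G M × HasDim L E (G M) m × SimpleExt L E (G M)
    step ≡.refl isE′ = E⊆E′ , basis⇒hasDim isE powers , α , E′⊆E[α] , E[α]⊆E′
      where
      module E′ = IsSubfield isE′
      powers : IsBasis E (G (m *ℕ N)) m (α ^_)
      powers = powers-basis-G (ℕ.<-trans z<s 1<m) ℕ.≤-refl
      N<mN : N < m *ℕ N
      N<mN = ℕ.<-≤-trans (ℕ.m<m+n N (0<jN {1} z<s)) (ℕ.*-monoˡ-≤ N 1<m)
      E⊆E′ : E ⊆ G (m *ℕ N)
      E⊆E′ = G-mono (ℕ.<⇒≤ N<mN)
      E[α]/E : IsSubspace L E (Adjoin L E α)
      E[α]/E = record
        { resp = ad-resp ; has0 = ad-base E.has0 ; +-cl = ad-+ ; smul = λ Ek → ad-* (ad-base Ek) }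
      E′⊆E[α] : G (m *ℕ N) ⊆ Adjoin L E α
      E′⊆E[α] Gx = Over.Subspace.combination-mem isE E[α]/E m {α ^_}
        (λ l _ → power-mem {V = Adjoin L E α} (ad-base E.has1) (λ _ → ad-* ad-gen) l)
        (IsBasis.span powers Gx)
      E[α]⊆E′ : Adjoin L E α ⊆ G (m *ℕ N)
      E[α]⊆E′ (ad-base Ex)    = E⊆E′ Ex
      E[α]⊆E′ ad-gen          = G-mono N<mN Gα
      E[α]⊆E′ (ad-+ u v)      = E′.+-cl (E[α]⊆E′ u) (E[α]⊆E′ v)
      E[α]⊆E′ (ad-neg u)      = E′.neg-cl (E[α]⊆E′ u)
      E[α]⊆E′ (ad-* u v)      = E′.*-cl (E[α]⊆E′ u) (E[α]⊆E′ v)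
      E[α]⊆E′ (ad-inv u eq)   = E′.inv-cl (E[α]⊆E′ u) eq
      E[α]⊆E′ (ad-resp eq u)  = E′.resp eq (E[α]⊆E′ u)

  tower : HasSimpleTower L K ns
  tower = (λ s → G (product (take (toℕ s) ns))) , (λ s → level-subfield (toℕ s)) ,
    G1⊆K , K⊆G z<s ,
    (λ x → ≡.subst (λ ns′ → G (product ns′) x) (≡.sym (≡.trans
      (≡.cong (λ k → take k ns) (Fin.toℕ-fromℕ (length ns))) (List.take-all _ ns ℕ.≤-refl)))
      (G-total x)) ,
    λ s → let post , split , prod = list-split ns s in
      ≡.subst (λ k → G (product (take k ns)) ⊆ G (product (take (suc (toℕ s)) ns)) ×
        HasDim L (G (product (take k ns))) (G (product (take (suc (toℕ s)) ns))) (lookup ns s) ×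
        SimpleExt L (G (product (take k ns))) (G (product (take (suc (toℕ s)) ns))))
        (≡.sym (Fin.toℕ-inject₁ s))
        (Step.step {take (toℕ s) ns} split prod (level-subfield (suc (toℕ s))))
    where
    level-subfield : ∀ k → IsSubfield L (G (product (take k ns)))
    level-subfield k = G-subfield {take k ns} {drop k ns} (List.take++drop≡id k ns)

-- From a tower to a flag

module TowerToFlag {c ℓ} (L : Field c ℓ) where
  open Field L hiding (zero)
  open import Relation.Binary.Reasoning.Setoid setoid
  open import Algebra.Properties.Semiring.Exp semiring using (_^_; ^-homo-*)
  open CommutativeSemigroupProperties *-commutativeSemigroup using (interchange; x∙yz≈y∙xz)
  open Sums commutativeRing
  open Linear L
  open Extensions L

  Everything : Pred Carrier (c ⊔ ℓ)
  Everything x = ⊤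

  -- A product with a carry depends on the algebraic relations of the generators; only a bound on
  -- the monomials occurring in it is recorded. That is enough for the flag type, and it survives
  -- adding a step at the bottom of the tower.
  record Monomials (S : Pred Carrier (c ⊔ ℓ)) (ns : List ℕ) : Set (c ⊔ ℓ) where
    field
      v       : ℕ → Carrier
      basis   : IsBasis S Everything (product ns) v
      first   : v 0 ≈ 1#
      noCarry : ∀ {a b} → NoCarry ns a b → v a * v b ≈ v (a +ℕ b)
      carry   : ∀ {a b k} → Carry ns a b k → Combination S (suc k) v (v a * v b)

  monomials-scalars : ∀ {S S′ ns} → S ⊆ S′ → S′ ⊆ S → Monomials S ns → Monomials S′ ns
  monomials-scalars S⊆S′ S′⊆S mono = record
    { v = v ; basis = basis-scalars S⊆S′ S′⊆S basis ; first = first ; noCarry = noCarry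
    ; carry = λ cr → let co , Sco , eq = carry cr in co , S⊆S′ ∘ Sco , eq }
    where open Monomials mono

  monomials-[] : ∀ {S} → IsSubfield L S → (∀ x → S x) → Monomials S []
  monomials-[] isS total = record
    { v       = λ _ → 1#
    ; basis   = record
      { mem   = λ _ _ → tt
      ; indep = λ { co _ eq zero _ → trans (sym (trans (+-identityʳ _) (*-identityʳ (co 0)))) eq
                  ; _ _ _ (suc _) (s≤s ()) }
      ; span  = λ {x} _ → (λ _ → x) , (λ _ → total x) ,
          sym (trans (+-identityʳ _) (*-identityʳ x))
      }
    ; first   = refl
    ; noCarry = λ _ → *-identityˡ 1#
    ; carry   = λ ()
    }

  Everything-subspace : ∀ {p} {S : Pred Carrier p} → IsSubspace L S Everything
  Everything-subspace = record
    { resp = λ _ _ → tt ; has0 = tt ; +-cl = λ _ _ → tt ; smul = λ _ _ → tt }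

  module _ {E E′ : Pred Carrier (c ⊔ ℓ)} (isE : IsSubfield L E) (isE′ : IsSubfield L E′)
    (E⊆E′ : E ⊆ E′) {m : ℕ} .{{_ : NonZero m}} {α : Carrier} (powers : IsBasis E E′ m (α ^_))
    (E′pow : ∀ i → E′ (α ^ i)) where

    private
      module E′ = IsSubfield isE′
      E′/E : IsSubspace L E E′
      E′/E = record { resp = E′.resp ; has0 = E′.has0 ; +-cl = E′.+-cl ; smul = E′.*-cl ∘ E⊆E′ }

    module _ {ms : List ℕ} (mono : Monomials E′ ms) where

      private module W = Monomials mono

      -- The generator of the lowest step takes the lowest digit, so the tower is processed from the
      -- top: first L over E′, then L over E.
      monomials-v : ℕ → Carrier
      monomials-v = products (α ^_) m W.v

      monomials-basis : IsBasis E Everything (m *ℕ product ms) monomials-v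
      monomials-basis = ≡.subst (λ n → IsBasis E Everything n monomials-v) (ℕ.*-comm (product ms) m)
        (products-basis m isE E′/E Everything-subspace powers (product ms) W.basis)

      v-* : ∀ a b → monomials-v a * monomials-v b ≈
        (α ^ (a % m) * α ^ (b % m)) * (W.v (a / m) * W.v (b / m))
      v-* a b = interchange _ _ _ _

      v-noCarry : ∀ {a b} → a % m +ℕ b % m < m → NoCarry ms (a / m) (b / m) →
        monomials-v a * monomials-v b ≈ monomials-v (a +ℕ b)
      v-noCarry {a} {b} small noCarry = begin
        monomials-v a * monomials-v b
          ≈⟨ v-* a b ⟩
        (α ^ (a % m) * α ^ (b % m)) * (W.v (a / m) * W.v (b / m))
          ≈⟨ *-cong (sym (^-homo-* α (a % m) (b % m))) (W.noCarry noCarry) ⟩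
        α ^ (a % m +ℕ b % m) * W.v (a / m +ℕ b / m)
          ≈⟨ reflexive (≡.cong₂ (λ r q → α ^ r * W.v q)
               (≡.sym (≡.trans (%-distribˡ-+ a b m) (m<n⇒m%n≡m small)))
               (≡.sym (+-distrib-/ a b small))) ⟩
        monomials-v (a +ℕ b) ∎

      -- The two powers of α are scalars from E′ and preserve the E′-span of the first q + 1 upper
      -- monomials. Over E this span is generated by the first (q + 1)m monomials, which is why a
      -- carry fills every lower digit with its maximum.
      v-carry : ∀ {a b q} → Combination E′ (suc q) W.v (W.v (a / m) * W.v (b / m)) →
        Combination E (suc q *ℕ m) monomials-v (monomials-v a * monomials-v b)
      v-carry {a} {b} {q} comb = products-combination m isE E′/E Everything-subspace powers (suc q) {W.v}
        (resp (sym (v-* a b)) (smul (E′.*-cl (E′pow (a % m)) (E′pow (b % m))) comb))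
        where open IsSubspace (Over.combination-subspace isE′ (suc q) W.v)

  monomials-∷ : ∀ {E E′} → IsSubfield L E → IsSubfield L E′ → E ⊆ E′ → ∀ {m} → 1 < m →
    ∀ {α} → IsBasis E E′ m (α ^_) → (∀ i → E′ (α ^ i)) →
    ∀ {ms} → Monomials E′ ms → Monomials E (m ∷ ms)
  monomials-∷ {E} {E′} isE isE′ E⊆E′ {m} (s≤s (s≤s z≤n)) {α} powers E′pow {ms} mono = record
    { v       = v
    ; basis   = monomials-basis isE isE′ E⊆E′ powers E′pow mono
    ; first   = trans (*-identityˡ _) W.first
    ; noCarry = λ {a} {b} (small , noCarry) →
        v-noCarry isE isE′ E⊆E′ powers E′pow mono {a} {b} small noCarry
    ; carry   = carry
    }
    where
    module W = Monomials mono
    v : ℕ → Carrier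
    v = monomials-v isE isE′ E⊆E′ powers E′pow mono
    carry : ∀ {a b k} → Carry (m ∷ ms) a b k → Combination E (suc k) v (v a * v b)
    -- The upper digits add without a carry and contribute the single monomial `W.v q`; the overflow
    -- in the lowest digit is absorbed by a scalar of E′.
    carry {a} {b} (low _ noCarry) = v-carry isE isE′ E⊆E′ powers E′pow mono {a} {b} {q}
      (resp (sym (W.noCarry noCarry)) (Over.generator isE′ (suc q) W.v q ℕ.≤-refl))
      where
      q : ℕ
      q = a / m +ℕ b / m
      open IsSubspace (Over.combination-subspace isE′ (suc q) W.v)
    carry {a} {b} (up {q = q} cr) = v-carry isE isE′ E⊆E′ powers E′pow mono {a} {b} {q} (W.carry cr)

  monomials : ∀ ns → All (1 <_) ns → (Ls : Fin (suc (length ns)) → Pred Carrier (c ⊔ ℓ)) →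
    (∀ s → IsSubfield L (Ls s)) → (∀ x → Ls (fromℕ (length ns)) x) →
    (∀ (s : Fin (length ns)) → Ls (inject₁ s) ⊆ Ls (fsuc s) ×
      HasDim L (Ls (inject₁ s)) (Ls (fsuc s)) (lookup ns s) ×
      SimpleExt L (Ls (inject₁ s)) (Ls (fsuc s))) →
    Monomials (Ls fzero) ns
  monomials []       []           Ls isLs total steps = monomials-[] (isLs fzero) total
  monomials (m ∷ ms) (1<m ∷ 1<ms) Ls isLs total steps
    with E⊆E′ , dim , α , E′⊆E[α] , E[α]⊆E′ ← steps fzero =
    monomials-∷ (isLs fzero) (isLs (fsuc fzero)) E⊆E′ 1<m
      (powers-basis (isLs fzero) (proj₂ (hasDim⇒basis (isLs fzero) dim)) E′⊆E[α] E′pow) E′pow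
      (monomials ms 1<ms (Ls ∘ fsuc) (isLs ∘ fsuc) total (steps ∘ fsuc))
    where
    module E′ = IsSubfield (isLs (fsuc fzero))
    E′pow : ∀ i → Ls (fsuc fzero) (α ^ i)
    E′pow = power-mem {V = Ls (fsuc fzero)} E′.has1 (λ _ → E′.*-cl (E[α]⊆E′ ad-gen))

  module _ {K : Pred Carrier (c ⊔ ℓ)} (isK : IsSubfield L K) {ns : List ℕ} (1<ns : All (1 <_) ns)
    (mono : Monomials K ns) where

    private
      n = product ns
      open Monomials mono
      module B = IsBasis basis
      open Over isK

    F : Fin n → Pred Carrier (c ⊔ ℓ)
    F i = Combination K (suc (toℕ i)) v

    -- Otherwise the l + 1 independent monomials up to `v l` would be spanned by the first l of
    -- them.
    monomial-index : ∀ {k l} → l < n → Combination K k v (v l) → l < k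
    monomial-index {k} {l} l<n comb = ℕ.≰⇒> λ k≤l →
      overspanned-dependent (lower k≤l) (weaken {w = v} (independent-≤ {w = v} l<n B.indep))
      where
      lower : k ≤ l → ∀ i → i < suc l → Combination K l v (v i)
      lower k≤l i i≤l with ℕ.m≤n⇒m<n∨m≡n (s≤s⁻¹ i≤l)
      ... | inj₁ i<l    = generator l v i i<l
      ... | inj₂ ≡.refl = combination-mono k≤l comb

    noCarry-+< : ∀ {a b} → a < n → b < n → NoCarry ns a b → a +ℕ b < n
    noCarry-+< {a} {b} a<n b<n noCarry′ = ≡.subst (_< n) (noCarry⇒index≡ 1<ns a<n b<n noCarry′)
      (index<product 1<ns a b)

    indexBound⇒monomials : ∀ {i j k} → i < n → j < n → IndexBound ns i j k →
      ∀ {a b} → a ≤ i → b ≤ j → Combination K (suc k) v (v a * v b)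
    indexBound⇒monomials {i} {j} {k} i<n j<n bound {a} {b} a≤i b≤j with carry? ns a b
    ... | inj₁ nc = IsSubspace.resp (combination-subspace (suc k) v) (sym (noCarry nc))
      (generator (suc k) v (a +ℕ b) (s≤s (≡.subst (_≤ k)
        (noCarry⇒index≡ 1<ns (ℕ.≤-<-trans a≤i i<n) (ℕ.≤-<-trans b≤j j<n) nc) (bound a b a≤i b≤j))))
    -- With a carry, the index of a and b may be smaller than k′. The bound is applied to a′ ≤ a and
    -- b′ ≤ b instead, whose index is exactly k′.
    ... | inj₂ (k′ , cr) with a′ , b′ , a′≤a , b′≤b , _ , nc , sum ← carry-reached cr =
      combination-mono {w = v} (s≤s (≡.subst (_≤ k)
        (≡.trans (noCarry⇒index≡ 1<ns (ℕ.≤-<-trans a′≤i i<n) (ℕ.≤-<-trans b′≤j j<n) nc) sum)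
        (bound a′ b′ a′≤i b′≤j))) (carry cr)
      where
      a′≤i : a′ ≤ i
      a′≤i = ℕ.≤-trans a′≤a a≤i
      b′≤j : b′ ≤ j
      b′≤j = ℕ.≤-trans b′≤b b≤j

    monomials⇒indexBound : ∀ {i j k} → i < n → j < n →
      (∀ {a b} → a ≤ i → b ≤ j → Combination K (suc k) v (v a * v b)) → IndexBound ns i j k
    monomials⇒indexBound {i} {j} {k} i<n j<n closed a b a≤i b≤j with carry? ns a b
    ... | inj₁ nc = ℕ.≤-trans (noCarry⇒index≤ ns nc) (sum≤k a≤i b≤j nc)
      where
      sum≤k : ∀ {a b} → a ≤ i → b ≤ j → NoCarry ns a b → a +ℕ b ≤ k
      sum≤k a≤i b≤j nc = s≤s⁻¹ (monomial-index
        (noCarry-+< (ℕ.≤-<-trans a≤i i<n) (ℕ.≤-<-trans b≤j j<n) nc)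
        (IsSubspace.resp (combination-subspace (suc k) v) (noCarry nc) (closed a≤i b≤j)))
    -- Dually, the hypothesis at a′ and b′ puts `v k′` into the span, so k′ ≤ k, and `carry⇒index≤`
    -- bounds the index of a and b by k′.
    ... | inj₂ (k′ , cr) with a′ , b′ , a′≤a , b′≤b , _ , nc , ≡.refl ← carry-reached cr =
      ℕ.≤-trans (carry⇒index≤ cr) (s≤s⁻¹ (monomial-index
        (noCarry-+< (ℕ.≤-<-trans a′≤i i<n) (ℕ.≤-<-trans b′≤j j<n) nc)
        (IsSubspace.resp (combination-subspace (suc k) v) (noCarry nc) (closed a′≤i b′≤j))))
      where
      a′≤i : a′ ≤ i
      a′≤i = ℕ.≤-trans a′≤a a≤i
      b′≤j : b′ ≤ j
      b′≤j = ℕ.≤-trans b′≤b b≤j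

    F-isFlag : IsFlag L K n F
    F-isFlag = record
      { subspace = λ i → combination-subspace (suc (toℕ i)) v
      ; dim      = λ i → basis⇒hasDim isK record
        { mem   = generator (suc (toℕ i)) v
        ; indep = independent-≤ {w = v} (Fin.toℕ<n i) B.indep
        ; span  = id
        }
      ; mono     = λ i j i≤j → combination-mono {w = v} (s≤s i≤j)
      ; first⊆K  = λ i i≡0 → F0⊆K (≡.cong suc i≡0)
      ; K⊆first  = λ i i≡0 → K⊆F0 (toℕ i)
      ; last     = λ i 1+i≡n x → ≡.subst (λ m → Combination K m v x) (≡.sym 1+i≡n) (B.span tt)
      }
      where
      module K = IsSubfield isK
      F0⊆K : ∀ {m} → m ≡ 1 → Combination K m v ⊆ K
      F0⊆K ≡.refl (co , Kco , x≈) = K.resp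
        (sym (trans x≈ (trans (+-identityʳ _) (trans (*-congˡ first) (*-identityʳ (co 0)))))) (Kco 0)
      K⊆F0 : ∀ m → K ⊆ Combination K (suc m) v
      K⊆F0 m {x} Kx = resp (trans (*-congˡ first) (*-identityʳ x)) (smul Kx (generator (suc m) v 0 z<s))
        where open IsSubspace (combination-subspace (suc m) v)

    F-* : ∀ {i j k} → IndexBound ns (toℕ i) (toℕ j) (toℕ k) → ∀ {x y} → F i x → F j y → F k (x * y)
    F-* {i} {j} {k} bound {x} {y} (a , Ka , x≈) (b , Kb , y≈) = resp
      (begin
        ∑ I (λ p → a p * ∑ J (λ q → b q * (v p * v q)))
          ≈⟨ ∑-cong I (λ p _ → *-congˡ {a p} (trans (∑-cong J (λ q _ → x∙yz≈y∙xz (b q) (v p) (v q)))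
               (sym (*-∑ J (v p) (λ q → b q * v q))))) ⟩
        ∑ I (λ p → a p * (v p * ∑ J (λ q → b q * v q)))
          ≈⟨ ∑-cong I (λ p _ → *-assoc (a p) (v p) (∑ J (λ q → b q * v q))) ⟨
        ∑ I (λ p → a p * v p * ∑ J (λ q → b q * v q))
          ≈⟨ ∑-* I (λ p → a p * v p) _ ⟨
        ∑ I (λ p → a p * v p) * ∑ J (λ q → b q * v q)
          ≈⟨ *-cong x≈ y≈ ⟨
        x * y ∎)
      (∑-mem I {λ p → a p * ∑ J (λ q → b q * (v p * v q))} (λ p p<I → smul (Ka p)
        (∑-mem J {λ q → b q * (v p * v q)} (λ q q<J → smul (Kb q)
          (indexBound⇒monomials (Fin.toℕ<n i) (Fin.toℕ<n j) bound (s≤s⁻¹ p<I) (s≤s⁻¹ q<J))))))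
      where
      open Subspace (combination-subspace (suc (toℕ k)) v)
      I J : ℕ
      I = suc (toℕ i)
      J = suc (toℕ j)

    prodSub⇒indexBound : ∀ i j k → ProdSubF L K F i j k → IndexBound ns (toℕ i) (toℕ j) (toℕ k)
    prodSub⇒indexBound i j k sub = monomials⇒indexBound (Fin.toℕ<n i) (Fin.toℕ<n j) λ {a} {b} a≤i b≤j →
      sub {v a * v b} (sp-resp (trans (+-identityʳ _) (*-identityˡ _)) (sp-step (IsSubfield.has1 isK)
        (v a , v b , generator (suc (toℕ i)) v a (s≤s a≤i) , generator (suc (toℕ j)) v b (s≤s b≤j) , refl)
        sp-zero))

    indexBound⇒prodSub : ∀ i j k → IndexBound ns (toℕ i) (toℕ j) (toℕ k) → ProdSubF L K F i j k
    indexBound⇒prodSub i j k bound = span⊆ L Fk λ (x , y , Fx , Fy , z≈xy) →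
      IsSubspace.resp Fk (sym z≈xy) (F-* {i} {j} {k} bound Fx Fy)
      where
      Fk : IsSubspace L K (F k)
      Fk = combination-subspace (suc (toℕ k)) v

    F-type : ∀ i j k → FlagTypeIs L K F i j k ⇔ TowerTypeIs ns (toℕ i) (toℕ j) (toℕ k)
    F-type i j k = mk⇔
      (λ (sub , min) → indexBound⇒prodSubH ns (prodSub⇒indexBound i j k sub) , λ k′ k′<k subH →
        let k′<n = ℕ.<-trans k′<k (Fin.toℕ<n k)
            k′≡  = Fin.toℕ-fromℕ< k′<n in
        min (fromℕ< k′<n) (≡.subst (_< toℕ k) (≡.sym k′≡) k′<k)
          (indexBound⇒prodSub i j (fromℕ< k′<n) (≡.subst (IndexBound ns (toℕ i) (toℕ j)) (≡.sym k′≡)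
            (prodSubH⇒indexBound 1<ns k′<n subH))))
      (λ (subH , min) → indexBound⇒prodSub i j k (prodSubH⇒indexBound 1<ns (Fin.toℕ<n k) subH) , λ k′ k′<k sub →
        min (toℕ k′) k′<k (indexBound⇒prodSubH ns (prodSub⇒indexBound i j k′ sub)))

theorem1p9 : ∀ {c ℓ} (L : Field c ℓ) (K : Pred (Field.Carrier L) (c ⊔ ℓ)) →
    IsSubfield L K →
    (n : ℕ) → HasDim L K (λ _ → ⊤ {c ⊔ ℓ}) n →
    (ns : List ℕ) → IsTowerType n ns →
    (Realizable L K n ns ⇔ HasSimpleTower L K ns)
theorem1p9 L K isK n _ ns (1<ns , ≡.refl) = mk⇔
  (λ (F , isF , type) → FlagToTower.tower L isK 1<ns isF type)
  (λ (Ls , isLs , L₀⊆K , K⊆L₀ , total , steps) →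
    let mono = monomials-scalars L₀⊆K K⊆L₀ (monomials ns 1<ns Ls isLs total steps) in
    F isK 1<ns mono , F-isFlag isK 1<ns mono , F-type isK 1<ns mono)
  where open TowerToFlag L
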